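{- The bijection $\Theta:\mathcal{F}_n\to\vec{C}_{n,1}$ and its inverse can be computed in linear time. That is, there is an algorithm which, given $n\ge 2$ and a function $f\in\mathcal{F}_n$ as the list of pairs $\langle i,f(i)\rangle$, $i=2,\ldots,n-1$, outputs in time $O(n)$ the list of pairs $\langle i,t_i\rangle$, $i=2,\ldots,n$, such that $(i,t_i)$ is the directed edge out of $i$ in $\Theta(f)$; and there is an algorithm which, given a tree $T\in\vec{C}_{n,1}$ as such a list of pairs, outputs in time $O(n)$ the list of pairs $\langle i,f(i)\rangle$, $i=2,\ldots,n-1$, for $f=\Theta^{ -1}(T)$.
   Context: Let $\mathcal{F}_n$ be the set of functions $f:\{2,\ldots,n-1\}\to\{1,\ldots,n\}$ and let $\vec{C}_{n,1}$ be the set of trees on the vertex set $\{1,\ldots,n\}$ rooted at $1$, with all edges directed towards the root $1$. The digraph $\mathrm{graph}(f)$ has vertex set $\{1,\ldots,n\}$ and edges $(i,f(i))$ for $i=2,\ldots,n-1$. The bijection $\Theta:\mathcal{F}_n\to\vec{C}_{n,1}$ (of Eğecioğlu and Remmel) is defined as follows. Let $c_1,\ldots,c_a$ be the directed cycles of $\mathrm{graph}(f)$ (loops, i.e. cycles of length $1$, included), ordered so that their maximum elements $m_1,\ldots,m_a$ satisfy $m_1>m_2>\cdots>m_a$, and put $l_i=f(m_i)$ (so $l_i=m_i$ if $c_i$ is a loop). Then $\Theta(f)$ is obtained from $\mathrm{graph}(f)$ by deleting the edges $(m_i,l_i)$ for $i=1,\ldots,a$ and adding the directed edges $(n,l_1)$,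 $(m_i,l_{i+1})$ for $i=1,\ldots,a-1$, and $(m_a,1)$. If $\mathrm{graph}(f)$ has no cycles, $\Theta(f)$ is obtained by adding the single directed edge $(n,1)$. Time is counted in elementary operations (array access, pointer updates, comparisons and assignments on integers of size at most polynomial in $n$, each at unit cost). -}

module Defs where

open import Data.Bool.Base using (Bool; true; false; if_then_else_)
open import Data.Fin.Base using (Fin; toℕ)
open import Data.Fin.Properties using (toℕ<n)
open import Data.List.Base using (List; []; _∷_; _∷ʳ_; map; tabulate; applyUpTo; length)
open import Data.List.Extrema.Nat using (max)
open import Data.List.Membership.Propositional using (_∈_; _∉_)
open import Data.List.Relation.Unary.Linked using (Linked)
open import Data.List.Relation.Unary.Unique.Propositional using (Unique)
open import Data.Nat.Base
open import Data.Nat.Properties using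
  (m≤m+n; +-monoʳ-<; m+[n∸m]≡n; <-≤-trans; ≤-reflexive; <⇒≤; m∸n≢0⇒n<m; n≮0)
open import Data.Product.Base using (∃-syntax; _×_; _,_; proj₁; proj₂)
open import Data.Sum.Base using (_⊎_)
open import Function.Bundles using (_⇔_)
open import Relation.Binary.Construct.Closure.ReflexiveTransitive using (Star)
open import Relation.Binary.Core using (Rel)
open import Relation.Binary.PropositionalEquality using (_≡_; subst)
open import Level using (0ℓ)

------------------------------------------------------------------------
-- Integer intervals {a, …, b} (empty when b < a)

-- The bounds are irrelevant, so elements are equal as soon as their
-- values are.
record ⟦_⋯_⟧ (a b : ℕ) : Set where
  constructor ⟪_⟫
  field
    value  : ℕ
    .{lower} : a ≤ value
    .{upper} : value ≤ b

open ⟦_⋯_⟧ public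

interval : ∀ a b → List ⟦ a ⋯ b ⟧
interval a b = tabulate {n = suc b ∸ a} λ k →
  ⟪ a + toℕ k ⟫ {m≤m+n a (toℕ k)} {inside (toℕ<n k)}
  where
  inside : ∀ {k} → k < suc b ∸ a → a + k ≤ b
  inside {k} k< = s≤s⁻¹ (<-≤-trans (+-monoʳ-< a k<) (≤-reflexive (m+[n∸m]≡n a≤1+b)))
    where
    a≤1+b : a ≤ suc b
    a≤1+b = <⇒≤ (m∸n≢0⇒n<m λ eq → n≮0 (subst (k <_) eq k<))

module _ {a b c d : ℕ} where

  data graph (h : ⟦ a ⋯ b ⟧ → ⟦ c ⋯ d ⟧) : Rel ℕ 0ℓ where
    edge : ∀ i → graph h (value i) (value (h i))

  pairs : (⟦ a ⋯ b ⟧ → ⟦ c ⋯ d ⟧) → List (ℕ × ℕ)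
  pairs h = map (λ i → value i , value (h i)) (interval a b)

------------------------------------------------------------------------
-- Functions and trees

𝓕 : ℕ → Set
𝓕 n = ⟦ 2 ⋯ n ∸ 1 ⟧ → ⟦ 1 ⋯ n ⟧

-- All edges point towards the root 1: there is one edge out of every
-- other vertex, none out of 1, and every vertex has a directed path to 1.
record C⃗ (n : ℕ) : Set where
  field
    parent : ⟦ 2 ⋯ n ⟧ → ⟦ 1 ⋯ n ⟧
    rooted : (i : ⟦ 1 ⋯ n ⟧) → Star (graph parent) (value i) 1

open C⃗ public

------------------------------------------------------------------------
-- The correspondence Θ

-- v ∷ vs is the sequence of vertices of a directed cycle, the last of
-- them having an edge back to v; a loop is the case vs = [].
IsCycle : Rel ℕ 0ℓ → ℕ → List ℕ → Set
IsCycle E v vs = Unique (v ∷ vs) × Linked E (v ∷ vs ∷ʳ v)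

IsCycleMaximum : Rel ℕ 0ℓ → ℕ → Set
IsCycleMaximum E m = ∃[ v ] ∃[ vs ] IsCycle E v vs × m ≡ max v vs

module _ {n : ℕ} (f : 𝓕 n) where

  -- Distinct cycles of graph f are disjoint, hence determined by their
  -- maxima.
  record IsCycleMaxima (ms : List ⟦ 2 ⋯ n ∸ 1 ⟧) : Set where
    field
      decreasing : Linked _>_ (map value ms)
      maxima     : ∀ m → m ∈ map value ms ⇔ IsCycleMaximum (graph f) m

  deleted : List ⟦ 2 ⋯ n ∸ 1 ⟧ → List (ℕ × ℕ)
  deleted = map λ m → value m , value (f m)

  -- addedFrom n (m₁ ∷ … ∷ mₐ ∷ []) is
  -- (n , f m₁) ∷ (m₁ , f m₂) ∷ … ∷ (mₐ₋₁ , f mₐ) ∷ (mₐ , 1) ∷ [].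
  addedFrom : ℕ → List ⟦ 2 ⋯ n ∸ 1 ⟧ → List (ℕ × ℕ)
  addedFrom s []       = (s , 1) ∷ []
  addedFrom s (m ∷ ms) = (s , value (f m)) ∷ addedFrom (value m) ms

  -- The relation T = Θ(f).
  IsΘ : C⃗ n → Set
  IsΘ T = ∃[ ms ] IsCycleMaxima ms ×
    (∀ i j → graph (parent T) i j ⇔
      ((graph f i j × (i , j) ∉ deleted ms) ⊎ (i , j) ∈ addedFrom n ms))

------------------------------------------------------------------------
-- A unit-cost machine

-- Finitely many integer variables and arrays occur in a program.  New
-- integers arise only from literals and ±1, so a run of k steps keeps
-- every integer within k plus the largest integer in the program and
-- the input.

Var Arr : Set
Var = ℕ
Arr = ℕ

record State : Set where
  constructor state
  field
    var : Var → ℕ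
    arr : Arr → ℕ → ℕ

open State public

_[_↦_] : {A : Set} → (ℕ → A) → ℕ → A → (ℕ → A)
(g [ x ↦ a ]) y = if y ≡ᵇ x then a else g y

setVar : Var → ℕ → State → State
setVar x a σ = record σ { var = var σ [ x ↦ a ] }

setArr : Arr → ℕ → ℕ → State → State
setArr A i a σ = record σ { arr = arr σ [ A ↦ arr σ A [ i ↦ a ] ] }

data Operand : Set where
  lit : ℕ → Operand
  `_  : Var → Operand

data Test : Set where
  _==_ _<<_ : Operand → Operand → Test

infix  6 _==_ _<<_
infix  5 _≔_ _≔suc_ _≔pred_ _≔⟨_[_]⟩ _[_]≔_
infixr 4 _⨾_

data Program : Set where
  skip               : Program
  _≔_ _≔suc_ _≔pred_ : Var → Operand → Program
  _≔⟨_[_]⟩           : Var → Arr → Operand → Program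
  _[_]≔_             : Arr → Operand → Operand → Program
  _⨾_                : Program → Program → Program
  cond               : Test → Program → Program → Program
  while              : Test → Program → Program

⟦_⟧ᵒ : Operand → State → ℕ
⟦ lit a ⟧ᵒ σ = a
⟦ ` x   ⟧ᵒ σ = var σ x

⟦_⟧ᵗ : Test → State → Bool
⟦ a == b ⟧ᵗ σ = ⟦ a ⟧ᵒ σ ≡ᵇ ⟦ b ⟧ᵒ σ
⟦ a << b ⟧ᵗ σ = ⟦ a ⟧ᵒ σ <ᵇ ⟦ b ⟧ᵒ σ

-- ⟨ p , σ ⟩⇓ τ in-steps k: started in σ, p halts in τ after k elementary
-- operations.
infix 3 ⟨_,_⟩⇓_in-steps_

data ⟨_,_⟩⇓_in-steps_ : Program → State → State → ℕ → Set where
  skip   : ∀ {σ} → ⟨ skip , σ ⟩⇓ σ in-steps 1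
  copy   : ∀ {σ x a} → ⟨ x ≔ a , σ ⟩⇓ setVar x (⟦ a ⟧ᵒ σ) σ in-steps 1
  incr   : ∀ {σ x a} → ⟨ x ≔suc a , σ ⟩⇓ setVar x (suc (⟦ a ⟧ᵒ σ)) σ in-steps 1
  decr   : ∀ {σ x a} → ⟨ x ≔pred a , σ ⟩⇓ setVar x (pred (⟦ a ⟧ᵒ σ)) σ in-steps 1
  read   : ∀ {σ x A i} → ⟨ x ≔⟨ A [ i ]⟩ , σ ⟩⇓ setVar x (arr σ A (⟦ i ⟧ᵒ σ)) σ in-steps 1
  write  : ∀ {σ A i a} →
           ⟨ A [ i ]≔ a , σ ⟩⇓ setArr A (⟦ i ⟧ᵒ σ) (⟦ a ⟧ᵒ σ) σ in-steps 1
  seq    : ∀ {p q ρ σ τ k l} →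
           ⟨ p , ρ ⟩⇓ σ in-steps k → ⟨ q , σ ⟩⇓ τ in-steps l →
           ⟨ p ⨾ q , ρ ⟩⇓ τ in-steps (k + l)
  then   : ∀ {t p q σ τ k} → ⟦ t ⟧ᵗ σ ≡ true →
           ⟨ p , σ ⟩⇓ τ in-steps k → ⟨ cond t p q , σ ⟩⇓ τ in-steps suc k
  else   : ∀ {t p q σ τ k} → ⟦ t ⟧ᵗ σ ≡ false →
           ⟨ q , σ ⟩⇓ τ in-steps k → ⟨ cond t p q , σ ⟩⇓ τ in-steps suc k
  done   : ∀ {t p σ} → ⟦ t ⟧ᵗ σ ≡ false → ⟨ while t p , σ ⟩⇓ σ in-steps 1
  again  : ∀ {t p ρ σ τ k l} → ⟦ t ⟧ᵗ ρ ≡ true →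
           ⟨ p , ρ ⟩⇓ σ in-steps k → ⟨ while t p , σ ⟩⇓ τ in-steps l →
           ⟨ while t p , ρ ⟩⇓ τ in-steps suc (k + l)

-- A list of pairs is held in two parallel arrays (0 and 1) indexed from
-- 0, its length in variable 1.  On input, variable 0 holds n, and all
-- remaining memory is zero.

entry : List (ℕ × ℕ) → ℕ → ℕ × ℕ
entry []       _       = 0 , 0
entry (x ∷ xs) zero    = x
entry (x ∷ xs) (suc k) = entry xs k

input : ℕ → List (ℕ × ℕ) → State
input n xs = state vars arrs
  where
  vars : Var → ℕ
  vars 0 = n
  vars 1 = length xs
  vars _ = 0
  arrs : Arr → ℕ → ℕ
  arrs 0 k = proj₁ (entry xs k)
  arrs 1 k = proj₂ (entry xs k)
  arrs _ k = 0

output : State → List (ℕ × ℕ)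
output σ = applyUpTo (λ k → arr σ 0 k , arr σ 1 k) (var σ 1)

infix 3 _on⟨_,_⟩outputs_within_

_on⟨_,_⟩outputs_within_ : Program → ℕ → List (ℕ × ℕ) → List (ℕ × ℕ) → ℕ → Set
p on⟨ n , xs ⟩outputs ys within t =
  ∃[ σ ] ∃[ k ] (⟨ p , input n xs ⟩⇓ σ in-steps k) × output σ ≡ ys × k ≤ t

{-# OPTIONS --safe #-}
-- The right-to-left maxima of the path from n to 1 in Θ(f) are the cycle
-- maxima of f: that path runs through the cycles of f one after the other,
-- each cut open behind its maximum.  So f can be recovered from Θ(f).
--
-- Given cycle maxima, Θ is computed in place: set f(n) = 1 and exchange,
-- for m = m₁, …, mₐ, the value at m with the value 1 at its predecessor in
-- n, m₁, …, mₐ.  The maxima are found by walking from every vertex through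
-- the uncoloured vertices and colouring them by the start of the walk; a
-- walk closes a new cycle if and only if it ends in its own colour.  Each
-- vertex is coloured once and pays for its share of the walk around the
-- cycle.  Θ⁻¹ is computed by walking from n to 1 and back, updating the
-- last right-to-left maximum whenever a larger vertex is met.
module Submission where

open import Defs
open import Data.Bool.Base using (true; false)
open import Data.Empty using (⊥; ⊥-elim)
open import Data.Fin.Base using (Fin; zero; suc; fromℕ<; toℕ)
open import Data.Fin.Properties using (fromℕ<-injective; injective⇒≤; toℕ-fromℕ<; toℕ<n)
open import Data.List.Base using
  (List; []; _∷_; _++_; _∷ʳ_; length; lookup; map; tabulate; applyUpTo; filter; applyDownFrom)
open import Data.List.Extrema.Nat using (max)
open import Data.List.Membership.Propositional using (_∈_; _∉_; find; lose)
open import Data.List.Membership.Propositional.Properties using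
  ( ∈-++⁺ˡ; ∈-++⁺ʳ; ∈-++⁻; ∈-lookup; ∈-filter⁺; ∈-filter⁻; ∈-applyDownFrom⁺; ∈-applyDownFrom⁻)
open import Data.List.Properties using
  (length-++; map-tabulate; length-map; length-tabulate; filter-accept; filter-reject)
open import Data.List.Relation.Unary.All as All using (All; []; _∷_)
import Data.List.Relation.Unary.All.Properties as All
open import Data.List.Relation.Unary.AllPairs using ([]; _∷_)
open import Data.List.Relation.Unary.Any using (here; there; any?)
open import Data.List.Relation.Unary.Linked using (Linked; []; [-]; _∷_)
import Data.List.Relation.Unary.Linked.Properties as Linked
open import Data.List.Relation.Unary.Unique.Propositional using (Unique)
open import Data.Nat.Base
open import Data.Nat.Properties
open import Data.List.Extrema ≤-totalOrder using (max≤v⁺; ⊥≤max; xs≤max; argmax-sel)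
open import Data.List.Membership.DecPropositional _≟_ using (_∈?_)
open import Data.Nat.Tactic.RingSolver using (solve-∀)
open import Data.Product.Base using (∃-syntax; _×_; _,_; proj₁; proj₂; map₂)
open import Data.Sum.Base using (_⊎_; inj₁; inj₂)
open import Function.Base using (_∘_; _$_; id)
open import Function.Bundles using (mk⇔; Equivalence)
open import Relation.Binary.Construct.Closure.ReflexiveTransitive using (Star; ε; _◅_)
open import Relation.Binary.PropositionalEquality
open import Relation.Nullary using (Dec; does; ¬_; yes; no; contradiction; recompute)
open import Relation.Nullary.Decidable using (dec-true; dec-false; ¬?)
open import Relation.Unary using (Decidable)

-- Paths of a function and their right-to-left maxima

-- `IsΘ` is only a relation, so the bijectivity of Θ has to be proved together with the time bounds.
-- The programs supply existence: the tree, or the function, is read off the final memory and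
-- justified by the loop invariants. Uniqueness is argued apart from the machine.
--
-- The decreasing order of the cycles is what makes the maxima recoverable. Behind the cut cycle of
-- a maximum come only cycles with smaller maxima, so the maximum exceeds all that follows it on the
-- path, while every other vertex of its cycle precedes it and is smaller.
--
-- Sorting the maxima would endanger linear time. They are therefore kept as marks in an array
-- indexed by the vertices, and scanning it downwards yields them in the required order.

infixr 5 _∷_

-- The vertices of the path are listed without the last one.
data Path (g : ℕ → ℕ) : ℕ → List ℕ → ℕ → Set where
  []  : ∀ {x} → Path g x [] x
  _∷_ : ∀ x {vs y} → Path g (g x) vs y → Path g x (x ∷ vs) y

module _ {g : ℕ → ℕ} where

  infixr 5 _++ᵖ_

  _++ᵖ_ : ∀ {x y z vs ws} → Path g x vs y → Path g y ws z → Path g x (vs ++ ws) z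
  []      ++ᵖ q = q
  (x ∷ p) ++ᵖ q = x ∷ (p ++ᵖ q)

  split : ∀ {x y v vs} → Path g x vs y → v ∈ vs →
          ∃[ as ] ∃[ bs ] Path g x as v × Path g (g v) bs y × vs ≡ as ++ v ∷ bs
  split (x ∷ p) (here refl) = [] , _ , [] , p , refl
  split (x ∷ p) (there v∈) with split p v∈
  ... | as , bs , q , r , refl = x ∷ as , bs , x ∷ q , r , refl

  -- Both paths must stop at their first visit to `z`; otherwise one of them could go on around a
  -- cycle through `z`.
  deterministic : ∀ {x z vs ws} → Path g x vs z → Path g x ws z → z ∉ vs → z ∉ ws → vs ≡ ws
  deterministic []      []      _  _  = refl
  deterministic []      (_ ∷ _) _  z∉ = contradiction (here refl) z∉
  deterministic (_ ∷ _) []      z∉ _  = contradiction (here refl) z∉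
  deterministic (x ∷ p) (_ ∷ q) z∉vs z∉ws =
    cong (x ∷_) (deterministic p q (z∉vs ∘ there) (z∉ws ∘ there))

  first∈ : ∀ {x y vs} → Path g x vs y → x ∈ y ∷ vs
  first∈ []      = here refl
  first∈ (_ ∷ _) = there (here refl)

  -- Going round the cycle first gives a second, longer path to z.
  acyclic : ∀ {x z v vs ws} → Path g x (v ∷ vs) x → z ∉ v ∷ vs → Path g x ws z → z ∉ ws → ⊥
  acyclic {z = z} {v} {vs} {ws} c z∉c p z∉p = m≢1+n+m (length ws) (begin
    length ws                   ≡⟨ cong length (deterministic p (c ++ᵖ p) z∉p z∉) ⟩
    suc (length (vs ++ ws))     ≡⟨ cong suc (length-++ vs) ⟩
    suc (length vs + length ws) ∎)
    where
    open ≡-Reasoning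
    z∉ : z ∉ (v ∷ vs) ++ ws
    z∉ z∈ with ∈-++⁻ (v ∷ vs) z∈
    ... | inj₁ z∈c = z∉c z∈c
    ... | inj₂ z∈p = z∉p z∈p

  -- A repeated vertex would close a cycle avoiding `z`, from which `z` could not be reached.
  unique : ∀ {x z vs} → Path g x vs z → z ∉ vs → Unique vs
  unique []      _  = []
  unique (x ∷ p) z∉ = All.¬Any⇒All¬ _ x∉ ∷ unique p (z∉ ∘ there)
    where
    x∉ : x ∉ _
    x∉ x∈ with split p x∈
    ... | as , bs , q , r , refl =
      acyclic (x ∷ q) (z∉ ∘ ∈-++⁺ˡ {xs = x ∷ as}) (x ∷ p) z∉

  -- Stopping at the first visit to `z` supplies the side condition of `deterministic`, `acyclic`
  -- and `unique`.
  truncate : ∀ {x z vs} → Path g x vs z →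
             ∃[ ws ] ∃[ us ] vs ≡ ws ++ us × Path g x ws z × z ∉ ws
  truncate []              = [] , [] , refl , [] , λ ()
  truncate {z = z} (x ∷ p) with z ≟ x
  ... | yes refl = [] , _ , refl , [] , λ ()
  ... | no z≢x with truncate p
  ...   | ws , us , refl , q , z∉ =
    x ∷ ws , us , refl , x ∷ q , λ { (here z≡x) → z≢x z≡x ; (there z∈) → z∉ z∈ }

  module _ {y cs} (c : Path g (g y) cs y) where

    cycle-closed : ∀ {x} → x ∈ y ∷ cs → g x ∈ y ∷ cs
    cycle-closed (here refl) = first∈ c
    cycle-closed (there x∈) with split c x∈
    ... | as , bs , _ , q , refl with first∈ q
    ...   | here gx≡y  = here gx≡y
    ...   | there gx∈ = there (∈-++⁺ʳ as (there gx∈))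

    confined : ∀ {x z vs} → Path g x vs z → x ∈ y ∷ cs → z ∈ y ∷ cs
    confined []      x∈ = x∈
    confined (_ ∷ p) x∈ = confined p (cycle-closed x∈)

reroute : ∀ {g h x z vs} → (∀ {v} → v ∈ vs → g v ≡ h v) → Path g x vs z → Path h x vs z
reroute             _  []      = []
reroute {h = h} {z = z} eq (x ∷ p) =
  x ∷ subst (λ y → Path h y _ z) (eq (here refl)) (reroute (eq ∘ there) p)

lookup-injective : ∀ {xs : List ℕ} → Unique xs → ∀ i j → lookup xs i ≡ lookup xs j → i ≡ j
lookup-injective (_  ∷ _) zero    zero    _  = refl
lookup-injective (x∉ ∷ _) zero    (suc j) eq = contradiction eq (All.lookup x∉ (∈-lookup j))
lookup-injective (x∉ ∷ _) (suc i) zero    eq = contradiction (sym eq) (All.lookup x∉ (∈-lookup i))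
lookup-injective (_  ∷ u) (suc i) (suc j) eq = cong suc (lookup-injective u i j eq)

-- Pigeonhole: the positions of the list inject into `Fin n`. This bounds both the path walked by
-- the inverse and the number of coloured vertices.
length≤ : ∀ {n xs} → Unique xs → All (_< n) xs → length xs ≤ n
length≤ u xs<n = injective⇒≤ {f = λ i → fromℕ< (All.lookup xs<n (∈-lookup i))}
  λ {i} {j} eq → lookup-injective u i j (fromℕ<-injective _ _ _ _ eq)

-- Cut cycles and right-to-left maxima, and how each yields the other

data Rewired (f g : ℕ → ℕ) : ℕ → List ℕ → Set where
  []  : ∀ {s} → g s ≡ 1 → Rewired f g s []
  _∷_ : ∀ {s m ms} → g s ≡ f m → Rewired f g m ms → Rewired f g s (m ∷ ms)

-- The path from s to 1 cut after its right-to-left maxima ms.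
data Layout (g : ℕ → ℕ) : ℕ → List ℕ → Set where
  []  : ∀ {s} → g s ≡ 1 → Layout g s []
  seg : ∀ {s m cs ms} → 2 ≤ m → m < s →
        Path g (g s) cs m → All (λ y → 2 ≤ y × y ≤ m) cs →
        Layout g m ms → Layout g s (m ∷ ms)

-- The strict bound makes `cs` stop at the first return to `m`, so the simplicity demanded by
-- `IsCycle` follows from `unique` and need not be carried along.
CycleMaximum : (ℕ → ℕ) → ℕ → ℕ → Set
CycleMaximum f n m =
  2 ≤ m × m < n × ∃[ cs ] Path f (f m) cs m × All (λ y → 2 ≤ y × y < m) cs

1∉ : ∀ {vs} {P : ℕ → Set} → All (λ y → 2 ≤ y × P y) vs → 1 ∉ vs
1∉ vs≥2 1∈ = <-irrefl refl (proj₁ (All.lookup vs≥2 1∈))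

cycle-max : ∀ {f n y m vs} → CycleMaximum f n y → Path f y vs m → m ≤ y
cycle-max (_ , _ , cs , c , cs<y) p with confined c p (here refl)
... | here refl = ≤-refl
... | there m∈  = <⇒≤ (proj₂ (All.lookup cs<y m∈))

-- The closed path need not be simple. Starting it at `m` and cutting it at the first return to `m`
-- turns the weak bound into a strict one.
cycle⇒maximum : ∀ {f n x m vs} → Path f (f x) vs x → All (λ y → 2 ≤ y × y < n) (x ∷ vs) →
                m ∈ x ∷ vs → All (_≤ m) (x ∷ vs) → CycleMaximum f n m
cycle⇒maximum {x = x} {m} {vs} c inside m∈ ≤m with split (x ∷ c) m∈
... | as , bs , q , r , eq with truncate (r ++ᵖ q)
...   | cs , us , eq′ , p , m∉cs =
  proj₁ (All.lookup inside m∈) , proj₂ (All.lookup inside m∈) , cs , p , All.tabulate below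
  where
  below : ∀ {y} → y ∈ cs → 2 ≤ y × y < m
  below {y} y∈ = proj₁ (All.lookup inside y∈′) , ≤∧≢⇒< (All.lookup ≤m y∈′) λ { refl → m∉cs y∈ }
    where
    y∈′ : y ∈ x ∷ vs
    y∈′ with ∈-++⁻ bs (subst (y ∈_) (sym eq′) (∈-++⁺ˡ y∈))
    ... | inj₁ y∈bs = subst (y ∈_) (sym eq) (∈-++⁺ʳ as (there y∈bs))
    ... | inj₂ y∈as = subst (y ∈_) (sym eq) (∈-++⁺ˡ y∈as)

module _ {g : ℕ → ℕ} where

  -- The maxima decrease and each bounds its own segment, so all that follows `s` lies below `s`. In
  -- this sense the entries of a layout are right-to-left maxima.
  descend : ∀ {s ms} → Layout g s ms →
            ∃[ vs ] Path g (g s) vs 1 × All (λ y → 2 ≤ y × y < s) vs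
  descend ([] gs≡1) = [] , subst (λ y → Path g y [] 1) (sym gs≡1) [] , []
  descend (seg 2≤m m<s p cs≤m l) with descend l
  ... | vs , q , vs<m = _ , p ++ᵖ (_ ∷ q)
    , All.++⁺ (All.map (λ (2≤y , y≤m) → 2≤y , ≤-<-trans y≤m m<s) cs≤m)
              ((2≤m , m<s) ∷ All.map (λ (2≤y , y<m) → 2≤y , <-trans y<m m<s) vs<m)

  sublayout : ∀ {s ms m} → Layout g s ms → m ∈ s ∷ ms → ∃[ ms′ ] Layout g m ms′
  sublayout l               (here refl) = _ , l
  sublayout (seg _ _ _ _ l) (there m∈)  = sublayout l m∈

  layout-< : ∀ {s ms} → Layout g s ms → All (λ m → 2 ≤ m × m < s) ms
  layout-< ([] _) = []
  layout-< (seg 2≤m m<s _ _ l) =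
    (2≤m , m<s) ∷ All.map (λ (2≤y , y<m) → 2≤y , <-trans y<m m<s) (layout-< l)

  layout-decreasing : ∀ {s ms} → Layout g s ms → Linked _>_ (s ∷ ms)
  layout-decreasing ([] _)              = [-]
  layout-decreasing (seg _ m<s _ _ l) = m<s ∷ layout-decreasing l

  layout-max : ∀ {s m ms} → Layout g s (m ∷ ms) →
               ∃[ vs ] Path g (g s) vs 1 × 1 ∉ vs × m ∈ vs × All (_≤ m) vs
  layout-max (seg {cs = cs} 2≤m m<s p cs≤m l) with descend l
  ... | vs , q , vs<m = _ , p ++ᵖ (_ ∷ q)
    , 1∉ (All.++⁺ cs≤m ((2≤m , ≤-refl) ∷ All.map (λ (2≤y , y<m) → 2≤y , <⇒≤ y<m) vs<m))
    , ∈-++⁺ʳ cs (here refl)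
    , All.++⁺ (All.map proj₂ cs≤m) (≤-refl ∷ All.map (<⇒≤ ∘ proj₂) vs<m)

  layout-step : ∀ {s m ms} → Layout g s (m ∷ ms) → g s ≢ 1
  layout-step l gs≡1 with layout-max l
  ... | _ , p , 1∉vs , m∈ , _
    with deterministic p (subst (λ y → Path g y [] 1) (sym gs≡1) []) 1∉vs (λ ())
  layout-step l gs≡1 | _ , p , 1∉vs , () , _ | refl

  layout-max≤ : ∀ {s m m′ ms ms′} → Layout g s (m ∷ ms) → Layout g s (m′ ∷ ms′) → m ≤ m′
  layout-max≤ l l′ with layout-max l | layout-max l′
  ... | _ , p , 1∉vs , m∈ , _ | _ , p′ , 1∉vs′ , _ , vs′≤m′
    with deterministic p p′ 1∉vs 1∉vs′
  ... | refl = All.lookup vs′≤m′ m∈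

  -- The first right-to-left maximum is the maximum of the whole path.
  layout-unique : ∀ {s ms ms′} → Layout g s ms → Layout g s ms′ → ms ≡ ms′
  layout-unique ([] _) ([] _) = refl
  layout-unique ([] gs≡1) l@(seg _ _ _ _ _) = contradiction gs≡1 (layout-step l)
  layout-unique l@(seg _ _ _ _ _) ([] gs≡1) = contradiction gs≡1 (layout-step l)
  layout-unique k@(seg _ _ _ _ l) k′@(seg _ _ _ _ l′)
    with ≤-antisym (layout-max≤ k k′) (layout-max≤ k′ k)
  ... | refl = cong (_ ∷_) (layout-unique l l′)

  rooted⇒acyclic : ∀ {x v vs ws} → Path g x (v ∷ vs) x → 1 ∉ v ∷ vs → Path g x ws 1 → ⊥
  rooted⇒acyclic c 1∉c p with truncate p
  ... | _ , _ , _ , q , 1∉q = acyclic c 1∉c q 1∉q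

module _ {f g : ℕ → ℕ} {n : ℕ} {ms : List ℕ}
  (rewired : Rewired f g n ms)
  (kept    : ∀ {y} → 2 ≤ y → y < n → y ∉ ms → g y ≡ f y)
  where

  module _ (sound : ∀ {m} → m ∈ ms → CycleMaximum f n m) where

    -- On the cycle of `m` the two functions can differ only at `m`: a vertex `v < m` of the cycle
    -- leads to `m`, so it is no cycle maximum and keeps its edge.
    maxima-layout : Linked _>_ (n ∷ ms) → Layout g n ms
    maxima-layout = go rewired (λ m∈ → m∈)
      where
      go : ∀ {s ms′} → Rewired f g s ms′ → (∀ {m} → m ∈ ms′ → m ∈ ms) →
           Linked _>_ (s ∷ ms′) → Layout g s ms′
      go ([] gs≡1) _ _ = [] gs≡1
      go (_∷_ {m = m} gs≡fm r) ⊆ms (s>m ∷ dec) with sound (⊆ms (here refl))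
      ... | 2≤m , m<n , cs , c , cs<m =
        seg 2≤m s>m
          (subst (λ y → Path g y cs m) (sym gs≡fm) (reroute f≡g c))
          (All.map (λ (2≤y , y<m) → 2≤y , <⇒≤ y<m) cs<m)
          (go r (⊆ms ∘ there) dec)
        where
        f≡g : ∀ {v} → v ∈ cs → f v ≡ g v
        f≡g v∈ with All.lookup cs<m v∈ | split c v∈
        ... | 2≤v , v<m | _ , _ , _ , q , _ =
          sym (kept 2≤v (<-trans v<m m<n)
                λ v∈ms → <⇒≱ v<m (cycle-max (sound v∈ms) (_ ∷ q)))

    -- Up to its first vertex in `n ∷ ms` a path of `f` is a path of `g`; from there the layout
    -- descends to 1.
    maxima-rooted : 2 ≤ n → Linked _>_ (n ∷ ms) →
      (∀ {x} → 2 ≤ x → x < n → ∃[ vs ] ∃[ z ] Path f x vs z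
        × All (λ y → 2 ≤ y × y < n) vs × (z ≡ 1 ⊎ z ∈ n ∷ ms)) →
      ∀ {x} → 1 ≤ x → x ≤ n → ∃[ ws ] Path g x ws 1 × All (λ y → 2 ≤ y × y ≤ n) ws
    maxima-rooted 2≤n dec reach = from
      where
      Descends : ℕ → Set
      Descends x = ∃[ ws ] Path g x ws 1 × All (λ y → 2 ≤ y × y ≤ n) ws

      top : ∀ {x} → x ∈ n ∷ ms → 2 ≤ x × x ≤ n
      top (here refl) = 2≤n , ≤-refl
      top (there x∈)  with sound x∈
      ... | 2≤x , x<n , _ = 2≤x , <⇒≤ x<n

      from-top : ∀ {x} → x ∈ n ∷ ms → Descends x
      from-top x∈ with sublayout (maxima-layout dec) x∈ | top x∈
      ... | _ , l | 2≤x , x≤n with descend l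
      ...   | _ , p , vs<x = _ , _ ∷ p
        , (2≤x , x≤n) ∷ All.map (λ (2≤y , y<x) → 2≤y , <⇒≤ (<-≤-trans y<x x≤n)) vs<x

      along : ∀ {x vs z} → Path f x vs z → All (λ y → 2 ≤ y × y < n) vs →
              z ≡ 1 ⊎ z ∈ n ∷ ms → Descends x
      along []      _ (inj₁ refl) = [] , [] , []
      along []      _ (inj₂ z∈)   = from-top z∈
      along (x ∷ p) ((2≤x , x<n) ∷ vs<n) z∈ with x ∈? n ∷ ms | along p vs<n z∈
      ... | yes x∈ | _ = from-top x∈
      ... | no  x∉ | ws , q , ws≤n = x ∷ ws
        , x ∷ subst (λ y → Path g y ws 1) (sym (kept 2≤x x<n (x∉ ∘ there))) q
        , (2≤x , <⇒≤ x<n) ∷ ws≤n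

      from : ∀ {x} → 1 ≤ x → x ≤ n → Descends x
      from 1≤x x≤n with m≤n⇒m<n∨m≡n 1≤x | m≤n⇒m<n∨m≡n x≤n
      ... | inj₂ refl | _         = [] , [] , []
      ... | inj₁ _    | inj₂ refl = from-top (here refl)
      ... | inj₁ 2≤x  | inj₁ x<n  with reach 2≤x x<n
      ...   | _ , _ , p , vs<n , z∈ = along p vs<n z∈

  module _ (layout : Layout g n ms)
    (rooted : ∀ {x} → 2 ≤ x → x < n → ∃[ vs ] Path g x vs 1)
    where

    -- A segment cut at its first visit to `m` closes up to a cycle because `f m` is its starting
    -- vertex. What remains is that it avoids `ms`, so that `f` and `g` agree on it.
    layout-sound : ∀ {m} → m ∈ ms → CycleMaximum f n m
    layout-sound = go rewired layout ≤-refl (λ m∈ → m∈)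
      where
      go : ∀ {s ms′} → Rewired f g s ms′ → Layout g s ms′ → s ≤ n →
           (∀ {m} → m ∈ ms′ → m ∈ ms) → ∀ {m} → m ∈ ms′ → CycleMaximum f n m
      go (_ ∷ r) (seg _ m<s _ _ l) s≤n ⊆ms (there m∈) =
        go r l (<⇒≤ (<-≤-trans m<s s≤n)) (⊆ms ∘ there) m∈
      go (_∷_ {m = m} gs≡fm r) (seg 2≤m m<s p cs≤m l) s≤n ⊆ms (here refl) with truncate p
      ... | cs , _ , refl , q , m∉cs = 2≤m , m<n , cs , subst (λ y → Path f y cs m) gs≡fm (reroute g≡f q)
          , All.tabulate bounds
        where
        m<n = <-≤-trans m<s s≤n
        bounds : ∀ {v} → v ∈ cs → 2 ≤ v × v < m
        bounds v∈ with All.lookup cs≤m (∈-++⁺ˡ v∈)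
        ... | 2≤v , v≤m = 2≤v , ≤∧≢⇒< v≤m λ { refl → m∉cs v∈ }
        g≡f : ∀ {v} → v ∈ cs → g v ≡ f v
        g≡f {v} v∈ = kept (proj₁ (bounds v∈)) (<-trans (proj₂ (bounds v∈)) m<n) v∉ms
          where
          v∉ms : v ∉ ms
          -- Were `v` in `ms`, the path from `v` to 1 would stay below `v` after leaving it; but it
          -- passes through `m`, which is larger.
          v∉ms v∈ms with sublayout layout (there v∈ms) | split q v∈ | descend l
          ... | _ , lᵥ | _ , bs , _ , q′ , refl | ds , d , ds<m with descend lᵥ
          ...   | vs , p′ , vs<v with deterministic p′ (q′ ++ᵖ (_ ∷ d)) (1∉ vs<v)
                    (1∉ (All.++⁺ {xs = bs}
                      (All.tabulate λ y∈ → map₂ <⇒≤ (bounds (∈-++⁺ʳ _ (there y∈))))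
                      ((2≤m , ≤-refl) ∷ All.map (map₂ <⇒≤) ds<m)))
          ...     | refl = <-asym (proj₂ (bounds v∈)) (proj₂ (All.lookup vs<v (∈-++⁺ʳ bs (here refl))))

    -- A cycle avoiding ms would be a cycle of g.
    layout-complete : ∀ {m} → CycleMaximum f n m → m ∈ ms
    layout-complete {m} (2≤m , m<n , cs , c , cs<m) with any? (_∈? ms) (m ∷ cs)
    ... | yes some with find some
    ...   | _ , here refl , m∈ = m∈
    ...   | y , there y∈  , y∈ms with split c y∈
    ...     | _ , _ , _ , q , _ =
      contradiction (cycle-max (layout-sound y∈ms) (y ∷ q)) (<⇒≱ (proj₂ (All.lookup cs<m y∈)))
    layout-complete {m} (2≤m , m<n , cs , c , cs<m) | no none with rooted 2≤m m<n
    ... | _ , p = ⊥-elim (rooted⇒acyclic (reroute f≡g (m ∷ c)) (1∉ cycle≤m) p)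
      where
      cycle≤m : All (λ y → 2 ≤ y × y ≤ m) (m ∷ cs)
      cycle≤m = (2≤m , ≤-refl) ∷ All.map (map₂ <⇒≤) cs<m
      f≡g : ∀ {v} → v ∈ m ∷ cs → f v ≡ g v
      f≡g v∈ with All.lookup cycle≤m v∈
      ... | 2≤v , v≤m = sym (kept 2≤v (≤-<-trans v≤m m<n) (none ∘ lose v∈))

-- The correspondence Θ on values

value-injective : ∀ {a b} {x y : ⟦ a ⋯ b ⟧} → value x ≡ value y → x ≡ y
value-injective refl = refl

bounds : ∀ {a b} (x : ⟦ a ⋯ b ⟧) → a ≤ value x × value x ≤ b
bounds {a} {b} (⟪ x ⟫ {a≤x} {x≤b}) = recompute (a ≤? x) a≤x , recompute (x ≤? b) x≤b

lift : ∀ {a b xs} → All (λ x → a ≤ x × x ≤ b) xs → ∃[ ys ] map {B = ℕ} (value {a} {b}) ys ≡ xs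
lift []                  = [] , refl
lift ((a≤x , x≤b) ∷ xs) with lift xs
... | ys , refl = ⟪ _ ⟫ {a≤x} {x≤b} ∷ ys , refl

-- `H` is total on ℕ and arbitrary outside the interval, so that the contents of an array can serve
-- as `H`.
Represents : ∀ {a b c d} → (⟦ a ⋯ b ⟧ → ⟦ c ⋯ d ⟧) → (ℕ → ℕ) → Set
Represents h H = ∀ i → H (value i) ≡ value (h i)

restrict : ∀ {a b c d} (H : ℕ → ℕ) →
           (∀ {x} → a ≤ x → x ≤ b → c ≤ H x × H x ≤ d) → ⟦ a ⋯ b ⟧ → ⟦ c ⋯ d ⟧
restrict H H≤ (⟪ x ⟫ {l} {u}) = ⟪ H x ⟫ {proj₁ (H≤ l u)} {proj₂ (H≤ l u)}

module _ {a b c d} {h : ⟦ a ⋯ b ⟧ → ⟦ c ⋯ d ⟧} {H} (rep : Represents h H) where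

  graph⁻ : ∀ {i j} → graph h i j → (a ≤ i × i ≤ b) × H i ≡ j
  graph⁻ (edge i) = bounds i , rep i

  graph⁺ : ∀ {i} → a ≤ i → i ≤ b → graph h i (H i)
  graph⁺ {i} a≤i i≤b = subst (graph h i) (sym (rep x)) (edge x)
    where x = ⟪ i ⟫ {a≤i} {i≤b}

  range : ∀ {i} → a ≤ i → i ≤ b → c ≤ H i × H i ≤ d
  range {i} a≤i i≤b = subst (λ y → c ≤ y × y ≤ d) (sym (rep x)) (bounds (h x))
    where x = ⟪ i ⟫ {a≤i} {i≤b}

  path⇒star : ∀ {x y vs} → Path H x vs y → All (λ v → a ≤ v × v ≤ b) vs → Star (graph h) x y
  path⇒star []      _                   = ε
  path⇒star (_ ∷ p) ((a≤x , x≤b) ∷ vs) = graph⁺ a≤x x≤b ◅ path⇒star p vs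

  star⇒path : ∀ {x y} → Star (graph h) x y →
              ∃[ vs ] Path H x vs y × All (λ v → a ≤ v × v ≤ b) vs
  star⇒path ε        = [] , [] , []
  star⇒path (e ◅ es) with graph⁻ e | star⇒path es
  ... | ab , refl | vs , p , vs≤ = _ , _ ∷ p , ab ∷ vs≤

  path⇒linked : ∀ {x y vs} → Path H x vs y → All (λ v → a ≤ v × v ≤ b) vs →
                Linked (graph h) (vs ∷ʳ y)
  path⇒linked []            _                   = [-]
  path⇒linked (_ ∷ [])      ((a≤x , x≤b) ∷ _)  = graph⁺ a≤x x≤b ∷ [-]
  path⇒linked (_ ∷ (_ ∷ p)) ((a≤x , x≤b) ∷ vs) = graph⁺ a≤x x≤b ∷ path⇒linked (_ ∷ p) vs

  linked⇒path : ∀ {y v} vs → Linked (graph h) (v ∷ vs ∷ʳ y) →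
                Path H (H v) vs y × All (λ v → a ≤ v × v ≤ b) (v ∷ vs)
  linked⇒path []       (e ∷ [-]) with graph⁻ e
  ... | ab , refl = [] , ab ∷ []
  linked⇒path (w ∷ vs) (e ∷ es)  with graph⁻ e | linked⇒path vs es
  ... | ab , refl | p , vs≤ = _ ∷ p , ab ∷ vs≤

-- Lists of pairs as array contents

entry-tabulate : ∀ {m k} (t : Fin m → ℕ × ℕ) (k<m : k < m) → entry (tabulate t) k ≡ t (fromℕ< k<m)
entry-tabulate {k = zero}  t z<s       = refl
entry-tabulate {k = suc k} t (s<s k<m) = entry-tabulate (t ∘ suc) k<m

applyUpTo-tabulate : ∀ {A : Set} {m} (g : ℕ → A) (t : Fin m → A) →
                     (∀ i → g (toℕ i) ≡ t i) → applyUpTo g m ≡ tabulate t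
applyUpTo-tabulate {m = zero}  g t eq = refl
applyUpTo-tabulate {m = suc m} g t eq =
  cong₂ _∷_ (eq zero) (applyUpTo-tabulate (g ∘ suc) (t ∘ suc) (eq ∘ suc))

module _ {N c d} (h : ⟦ 2 ⋯ suc N ⟧ → ⟦ c ⋯ d ⟧) where

  length-pairs : length (pairs h) ≡ N
  length-pairs = trans (length-map _ (interval 2 (suc N))) (length-tabulate {n = N} _)

  entry-pairs : ∀ {k} (x : ⟦ 2 ⋯ suc N ⟧) → value x ≡ 2 + k →
                entry (pairs h) k ≡ (value x , value (h x))
  entry-pairs {k} x refl = trans (cong (λ xs → entry xs k) (map-tabulate {n = N} _ _))
    (trans (entry-tabulate {N} _ k<N)
      (cong (λ y → value y , value (h y)) (value-injective (cong (2 +_) (toℕ-fromℕ< k<N)))))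
    where k<N = s≤s⁻¹ (proj₂ (bounds x))

  output-pairs : ∀ (σ : State) {H} → Represents h H → var σ 1 ≡ N →
                 (∀ {k} → k < N → arr σ 0 k ≡ 2 + k) → (∀ {k} → k < N → arr σ 1 k ≡ H (2 + k)) →
                 output σ ≡ pairs h
  output-pairs σ {H} rep refl arr0 arr1 =
    trans (applyUpTo-tabulate _ _ λ i → cong₂ _,_ (arr0 (toℕ<n i)) (trans (arr1 (toℕ<n i)) (rep _)))
          (sym (map-tabulate {n = N} _ _))

module _ {N : ℕ} {f : 𝓕 (2 + N)} {F} (rep : Represents f F) where

  isCycleMaximum⇒ : ∀ {m} → IsCycleMaximum (graph f) m → CycleMaximum F (2 + N) m
  isCycleMaximum⇒ (v , vs , (_ , linked) , refl) with linked⇒path rep vs linked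
  ... | p , vs≤ = cycle⇒maximum p (All.map (map₂ s≤s) vs≤) max∈ (⊥≤max v vs ∷ xs≤max v vs)
    where
    max∈ : max v vs ∈ v ∷ vs
    max∈ with argmax-sel id v vs
    ... | inj₁ eq = here eq
    ... | inj₂ m∈ = there m∈

  isCycleMaximum⇐ : ∀ {m} → CycleMaximum F (2 + N) m → IsCycleMaximum (graph f) m
  isCycleMaximum⇐ {m} (2≤m , m<n , cs , c , cs<m) =
    m , cs , (All.¬Any⇒All¬ _ m∉ ∷ unique c m∉ , path⇒linked rep (m ∷ c) inside)
      , ≤-antisym (⊥≤max m cs) (max≤v⁺ ≤-refl (All.map (<⇒≤ ∘ proj₂) cs<m))
    where
    m∉ : m ∉ cs
    m∉ m∈ = <-irrefl refl (proj₂ (All.lookup cs<m m∈))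
    inside : All (λ y → 2 ≤ y × y ≤ suc N) (m ∷ cs)
    inside = (2≤m , s≤s⁻¹ m<n) ∷ All.map (map₂ λ y<m → s≤s⁻¹ (<-trans y<m m<n)) cs<m

-- G represents Θ(f) for the function f represented by F, and ms lists the
-- cycle maxima of f.
record ΘData (F G : ℕ → ℕ) (n : ℕ) (ms : List ℕ) : Set where
  field
    decreasing : Linked _>_ (n ∷ ms)
    sound      : ∀ {m} → m ∈ ms → CycleMaximum F n m
    complete   : ∀ {m} → CycleMaximum F n m → m ∈ ms
    rewired    : Rewired F G n ms
    kept       : ∀ {y} → 2 ≤ y → y < n → y ∉ ms → G y ≡ F y

  layout : Layout G n ms
  layout = maxima-layout rewired kept sound decreasing

module _ {F : ℕ → ℕ} where

  rewired-target : ∀ {G G′ s ms i} → Rewired F G s ms → Rewired F G′ s ms → i ∈ s ∷ ms → G i ≡ G′ i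
  rewired-target ([] eq)  ([] eq′)  (here refl) = trans eq (sym eq′)
  rewired-target (eq ∷ _) (eq′ ∷ _) (here refl) = trans eq (sym eq′)
  rewired-target (_ ∷ r)  (_ ∷ r′)  (there i∈)  = rewired-target r r′ i∈

  rewired-source : ∀ {F′ G s ms i} → Rewired F G s ms → Rewired F′ G s ms → i ∈ ms → F i ≡ F′ i
  rewired-source (eq ∷ _) (eq′ ∷ _) (here refl) = trans (sym eq) eq′
  rewired-source (_ ∷ r)  (_ ∷ r′)  (there i∈)  = rewired-source r r′ i∈

decreasing-head : ∀ {m ms} → Linked _>_ (m ∷ ms) → ∀ {x} → x ∈ m ∷ ms → x ≤ m
decreasing-head _       (here refl) = ≤-refl
decreasing-head (m> ∷ l) (there x∈) = <⇒≤ (≤-<-trans (decreasing-head l x∈) m>)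

decreasing-tail : ∀ {m ms} → Linked _>_ (m ∷ ms) → ∀ {x} → x ∈ ms → x < m
decreasing-tail (m> ∷ l) x∈ = ≤-<-trans (decreasing-head l x∈) m>

tail : ∀ {m ms} → Linked _>_ (m ∷ ms) → Linked _>_ ms
tail [-]     = []
tail (_ ∷ l) = l

-- The heads are both the largest element of the same set, and strict decrease lets them be removed.
-- Thus `f` fixes the list of maxima in `IsΘ`.
decreasing-unique : ∀ {xs ys} → Linked _>_ xs → Linked _>_ ys →
                    (∀ {x} → x ∈ xs → x ∈ ys) → (∀ {x} → x ∈ ys → x ∈ xs) → xs ≡ ys
decreasing-unique {[]}     {[]}     _  _  _ _ = refl
decreasing-unique {[]}     {_ ∷ _} _  _  _  ⊇ = contradiction (⊇ (here refl)) λ ()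
decreasing-unique {_ ∷ _} {[]}     _  _  ⊆ _  = contradiction (⊆ (here refl)) λ ()
decreasing-unique {x ∷ xs} {y ∷ ys} l l′ ⊆ ⊇
  with ≤-antisym (decreasing-head l′ (⊆ (here refl))) (decreasing-head l (⊇ (here refl)))
... | refl = cong (x ∷_) (decreasing-unique (tail l) (tail l′) (drop l ⊆) (drop l′ ⊇))
  where
  drop : ∀ {us vs} → Linked _>_ (x ∷ us) → (∀ {z} → z ∈ x ∷ us → z ∈ x ∷ vs) →
         ∀ {z} → z ∈ us → z ∈ vs
  drop l i z∈ with i (there z∈)
  ... | here refl = contradiction (decreasing-tail l z∈) (<-irrefl refl)
  ... | there z∈′ = z∈′

module _ {N : ℕ} {f : 𝓕 (2 + N)} {F} (repF : Represents f F)
         {T : C⃗ (2 + N)} {G} (repG : Represents (parent T) G) where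

  private n = 2 + N

  deleted⇒∈ : ∀ ms {i j} → (i , j) ∈ deleted f ms → i ∈ map value ms
  deleted⇒∈ (_ ∷ _)  (here refl) = here refl
  deleted⇒∈ (_ ∷ ms) (there e)   = there (deleted⇒∈ ms e)

  isΘ⇒ : IsΘ f T → ∃[ ms ] ΘData F G n ms
  isΘ⇒ (ms , isMax , edges) = map value ms , record
    { decreasing = above ms decreasing
    ; sound      = λ m∈ → isCycleMaximum⇒ repF (to (maxima _) m∈)
    ; complete   = λ c → from (maxima _) (isCycleMaximum⇐ repF c)
    ; rewired    = rewire n ms λ e → proj₂ (graph⁻ repG (from (edges _ _) (inj₂ e)))
    ; kept       = λ {y} 2≤y y<n y∉ → proj₂ (graph⁻ repG (from (edges _ _)
                     (inj₁ (graph⁺ repF 2≤y (s≤s⁻¹ y<n) , y∉ ∘ deleted⇒∈ ms))))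
    }
    where
    open IsCycleMaxima isMax
    open Equivalence

    above : ∀ ms → Linked _>_ (map value ms) → Linked _>_ (n ∷ map value ms)
    above []       _ = [-]
    above (m ∷ ms) l = s≤s (proj₂ (bounds m)) ∷ l

    rewire : ∀ s ms → (∀ {i j} → (i , j) ∈ addedFrom f s ms → G i ≡ j) →
             Rewired F G s (map value ms)
    rewire s []       eq = [] (eq (here refl))
    rewire s (m ∷ ms) eq = trans (eq (here refl)) (sym (repF m)) ∷ rewire (value m) ms (eq ∘ there)

  isΘ⇐ : ∀ {ms} → ΘData F G n ms → IsΘ f T
  isΘ⇐ {ms} d with lift inside
    where
    inside : All (λ m → 2 ≤ m × m ≤ suc N) ms
    inside = All.tabulate λ m∈ → let (2≤m , m<n , _) = ΘData.sound d m∈ in 2≤m , s≤s⁻¹ m<n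
  ... | is , refl = is , record
      { decreasing = tail decreasing
      ; maxima     = λ m → mk⇔ (isCycleMaximum⇐ {f = f} repF ∘ sound)
                               (complete ∘ isCycleMaximum⇒ {f = f} repF)
      }
    , λ i j → mk⇔ old new
    where
    open ΘData d

    added-all : ∀ {s} ms → Rewired F G s (map value ms) →
                ∀ {i} → i ∈ s ∷ map value ms → (i , G i) ∈ addedFrom f s ms
    added-all []       ([] eq) (here refl) = here (cong (_ ,_) eq)
    added-all (m ∷ ms) (eq ∷ r) (here refl) = here (cong (_ ,_) (trans eq (repF m)))
    added-all (m ∷ ms) (eq ∷ r) (there i∈)  = there (added-all ms r i∈)

    added-only : ∀ {s} ms → Rewired F G s (map value ms) →
                 ∀ {i j} → (i , j) ∈ addedFrom f s ms → i ∈ s ∷ map value ms × G i ≡ j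
    added-only []       ([] eq) (here refl) = here refl , eq
    added-only (m ∷ ms) (eq ∷ r) (here refl) = here refl , trans eq (repF m)
    added-only (m ∷ ms) (eq ∷ r) (there e) with added-only ms r e
    ... | i∈ , eq′ = there i∈ , eq′

    deleted-all : ∀ ms {i} → i ∈ map value ms → (i , F i) ∈ deleted f ms
    deleted-all (m ∷ ms) (here refl) = here (cong (_ ,_) (repF m))
    deleted-all (m ∷ ms) (there i∈)  = there (deleted-all ms i∈)

    old : ∀ {i j} → graph (parent T) i j →
          (graph f i j × (i , j) ∉ deleted f is) ⊎ (i , j) ∈ addedFrom f n is
    old {i} e with graph⁻ repG e | i ∈? n ∷ map value is
    ... | _ , refl | yes i∈ = inj₂ (added-all is rewired i∈)
    ... | (2≤i , i≤n) , refl | no i∉ = inj₁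
      ( subst (graph f i) (sym (kept 2≤i i<n (i∉ ∘ there))) (graph⁺ repF 2≤i (s≤s⁻¹ i<n))
      , i∉ ∘ there ∘ deleted⇒∈ is)
      where i<n = ≤∧≢⇒< i≤n (i∉ ∘ here)

    new : ∀ {i j} → (graph f i j × (i , j) ∉ deleted f is) ⊎ (i , j) ∈ addedFrom f n is →
          graph (parent T) i j
    new {i} (inj₁ (e , ∉del)) with graph⁻ repF e | i ∈? map value is
    ... | _ , refl | yes i∈ = contradiction (deleted-all is i∈) ∉del
    ... | (2≤i , i<n) , refl | no i∉ =
      subst (graph (parent T) i) (kept 2≤i (s≤s i<n) i∉) (graph⁺ repG 2≤i (<⇒≤ (s≤s i<n)))
    new {i} (inj₂ e) with added-only is rewired e
    ... | i∈ , refl = graph⁺ repG (proj₁ (range′ i∈)) (proj₂ (range′ i∈))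
      where
      range′ : i ∈ n ∷ map value is → 2 ≤ i × i ≤ n
      range′ (here refl) = s≤s (s≤s z≤n) , ≤-refl
      range′ (there i∈) with sound i∈
      ... | 2≤i , i<n , _ = 2≤i , <⇒≤ i<n

-- Written so as to agree definitionally with array 1 of `input` read at vertex `x`, whose pair is
-- stored at position `x - 2`.
code : ∀ {N c d} → (⟦ 2 ⋯ suc N ⟧ → ⟦ c ⋯ d ⟧) → ℕ → ℕ
code h x = proj₂ (entry (pairs h) (pred (pred x)))

code-represents : ∀ {N c d} (h : ⟦ 2 ⋯ suc N ⟧ → ⟦ c ⋯ d ⟧) → Represents h (code h)
code-represents h x with bounds x
... | s≤s (s≤s _) , _ = cong proj₂ (entry-pairs h x refl)

-- At most one value and at most one preimage under Θ

module _ {N : ℕ} {f : 𝓕 (2 + N)} {T : C⃗ (2 + N)} {F G}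
         (repF : Represents f F) (repG : Represents (parent T) G)
         {ms} (d : ΘData F G (2 + N) ms) where

  open ΘData

  -- Both trees belong to the same list of cycle maxima, which fixes the added edges; elsewhere both
  -- follow `f`.
  Θ-functional : ∀ T′ → IsΘ f T′ → parent T′ ≗ parent T
  Θ-functional T′ isΘ i with isΘ⇒ {f = f} repF {T = T′} (code-represents (parent T′)) isΘ
  ... | ms′ , d′ with decreasing-unique (tail (decreasing d′)) (tail (decreasing d))
                        (λ m∈ → complete d (sound d′ m∈)) (λ m∈ → complete d′ (sound d m∈))
  ...   | refl = value-injective (begin
    value (parent T′ i)         ≡⟨ code-represents (parent T′) i ⟨
    code (parent T′) (value i)  ≡⟨ same ⟩
    G (value i)                 ≡⟨ repG i ⟩
    value (parent T i)          ∎)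
    where
    open ≡-Reasoning
    same : code (parent T′) (value i) ≡ G (value i)
    same with value i ∈? 2 + N ∷ ms
    ... | yes i∈ = rewired-target (rewired d′) (rewired d) i∈
    ... | no  i∉ = trans (kept d′ 2≤i i<n (i∉ ∘ there)) (sym (kept d 2≤i i<n (i∉ ∘ there)))
      where
      2≤i = proj₁ (bounds i)
      i<n = ≤∧≢⇒< (proj₂ (bounds i)) (i∉ ∘ here)

  -- The maxima of `f′` and of `f` are both layouts of the same tree, hence equal. The added edges
  -- then give back the values at the maxima.
  Θ-injective : ∀ f′ → IsΘ f′ T → f′ ≗ f
  Θ-injective f′ isΘ i with isΘ⇒ (code-represents f′) {T} repG isΘ
  ... | ms′ , d′ with layout-unique (layout d′) (layout d)
  ...   | refl = value-injective (begin
    value (f′ i)         ≡⟨ code-represents f′ i ⟨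
    code f′ (value i)    ≡⟨ same ⟩
    F (value i)          ≡⟨ repF i ⟩
    value (f i)          ∎)
    where
    open ≡-Reasoning
    same : code f′ (value i) ≡ F (value i)
    same with value i ∈? ms
    ... | yes i∈ = rewired-source (rewired d′) (rewired d) i∈
    ... | no  i∉ = trans (sym (kept d′ 2≤i i<n i∉)) (kept d 2≤i i<n i∉)
      where
      2≤i = proj₁ (bounds i)
      i<n = s≤s (proj₂ (bounds i))

-- Running programs on credit

≡ᵇ-true : ∀ {x y} → x ≡ y → (x ≡ᵇ y) ≡ true
≡ᵇ-true {x} {y} = dec-true (x ≟ y)

≡ᵇ-false : ∀ {x y} → x ≢ y → (x ≡ᵇ y) ≡ false
≡ᵇ-false {x} {y} = dec-false (x ≟ y)

<ᵇ-true : ∀ {x y} → x < y → (x <ᵇ y) ≡ true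
<ᵇ-true {x} {y} = dec-true (x <? y)

<ᵇ-false : ∀ {x y} → y ≤ x → (x <ᵇ y) ≡ false
<ᵇ-false {x} {y} y≤x = dec-false (x <? y) (≤⇒≯ y≤x)

module _ {A : Set} (g : ℕ → A) where

  updated : ∀ {x y a} → y ≡ x → (g [ x ↦ a ]) y ≡ a
  updated {x} {y} eq rewrite ≡ᵇ-true eq = refl

  untouched : ∀ {x y a} → y ≢ x → (g [ x ↦ a ]) y ≡ g y
  untouched {x} {y} y≢x rewrite ≡ᵇ-false y≢x = refl

-- Started in σ with μ credits, p halts in a state τ, each step costing a
-- credit, and Q holds of the credits left and τ.
record Runs (p : Program) (μ : ℕ) (σ : State) (Q : ℕ → State → Set) : Set where
  constructor runs
  field
    {final}   : State
    {steps}   : ℕ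
    {left}    : ℕ
    execution : ⟨ p , σ ⟩⇓ final in-steps steps
    cost      : steps + left ≤ μ
    post      : Q left final

module _ {Q : ℕ → State → Set} where

  with-credit : ∀ {p μ ν σ} → ν ≤ μ → Runs p ν σ Q → Runs p μ σ Q
  with-credit ν≤μ (runs e c q) = runs e (≤-trans c ν≤μ) q

  skips : ∀ {μ σ} → Q μ σ → Runs skip (suc μ) σ Q
  skips = runs skip ≤-refl

  copies : ∀ {x a μ σ} → Q μ (setVar x (⟦ a ⟧ᵒ σ) σ) → Runs (x ≔ a) (suc μ) σ Q
  copies = runs copy ≤-refl

  increments : ∀ {x a μ σ} → Q μ (setVar x (suc (⟦ a ⟧ᵒ σ)) σ) → Runs (x ≔suc a) (suc μ) σ Q
  increments = runs incr ≤-refl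

  decrements : ∀ {x a μ σ} → Q μ (setVar x (pred (⟦ a ⟧ᵒ σ)) σ) → Runs (x ≔pred a) (suc μ) σ Q
  decrements = runs decr ≤-refl

  reads : ∀ {x A i μ σ} → Q μ (setVar x (arr σ A (⟦ i ⟧ᵒ σ)) σ) → Runs (x ≔⟨ A [ i ]⟩) (suc μ) σ Q
  reads = runs read ≤-refl

  writes : ∀ {A i a μ σ} → Q μ (setArr A (⟦ i ⟧ᵒ σ) (⟦ a ⟧ᵒ σ) σ) → Runs (A [ i ]≔ a) (suc μ) σ Q
  writes = runs write ≤-refl

  -- The rest of the program sits in the postcondition and receives the remaining credits.
  -- Straight-line code is thus verified by one combinator per instruction, in program order.
  seqs : ∀ {p q μ σ} → Runs p μ σ (λ ν τ → Runs q ν τ Q) → Runs (p ⨾ q) μ σ Q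
  seqs {μ = μ} (runs {steps = k} e c (runs {steps = l} {ν} e′ c′ q)) = runs (seq e e′) (begin
    k + l + ν   ≡⟨ +-assoc k l ν ⟩
    k + (l + ν) ≤⟨ +-monoʳ-≤ k c′ ⟩
    k + _       ≤⟨ c ⟩
    μ           ∎) q
    where open ≤-Reasoning

  thens : ∀ {t p q μ σ} → ⟦ t ⟧ᵗ σ ≡ true → Runs p μ σ Q → Runs (cond t p q) (suc μ) σ Q
  thens t (runs e c r) = runs (then t e) (s≤s c) r

  elses : ∀ {t p q μ σ} → ⟦ t ⟧ᵗ σ ≡ false → Runs q μ σ Q → Runs (cond t p q) (suc μ) σ Q
  elses t (runs e c r) = runs (else t e) (s≤s c) r

  branches : ∀ {B : Set} (b? : Dec B) {t p q μ σ} → ⟦ t ⟧ᵗ σ ≡ does b? →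
             (B → Runs p μ σ Q) → (¬ B → Runs q μ σ Q) → Runs (cond t p q) (suc μ) σ Q
  branches (yes b) t r _ = thens t (r b)
  branches (no ¬b) t _ r = elses t (r ¬b)

  halts : ∀ {t p μ σ} → ⟦ t ⟧ᵗ σ ≡ false → Q μ σ → Runs (while t p) (suc μ) σ Q
  halts t = runs (done t) ≤-refl

  loops : ∀ {t p μ σ} → ⟦ t ⟧ᵗ σ ≡ true → Runs p μ σ (λ ν τ → Runs (while t p) ν τ Q) →
          Runs (while t p) (suc μ) σ Q
  loops t (runs {steps = k} e c (runs {steps = l} {ν} e′ c′ q)) = runs (again t e e′) (s≤s (begin
    k + l + ν   ≡⟨ +-assoc k l ν ⟩
    k + (l + ν) ≤⟨ +-monoʳ-≤ k c′ ⟩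
    k + _       ≤⟨ c ⟩
    _           ∎)) q
    where open ≤-Reasoning

conclude : ∀ {p μ σ P Q} → Runs p μ σ P → (∀ {ν τ} → P ν τ → Q ν τ) → Runs p μ σ Q
conclude (runs e c r) P⇒Q = runs e c (P⇒Q r)

-- The cell of array 1 that belongs to vertex x ≥ 2.
cell : ℕ → ℕ
cell x = pred (pred x)

cell-injective : ∀ {x y} → 2 ≤ x → 2 ≤ y → cell x ≡ cell y → x ≡ y
cell-injective (s≤s (s≤s _)) (s≤s (s≤s _)) eq = cong (2 +_) eq

fetch : Var → Var → Program
fetch x y = 4 ≔pred ` y ⨾ 4 ≔pred ` 4 ⨾ x ≔⟨ 1 [ ` 4 ]⟩

store : Var → Operand → Program
store y a = 4 ≔pred ` y ⨾ 4 ≔pred ` 4 ⨾ 1 [ ` 4 ]≔ a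

-- Computing Θ⁻¹

-- Variable 3 is the current vertex, 5 the value fetched at it, 6 the latest right-to-left maximum
-- and 4 a scratch index; array 2 holds the pointers back. Lowering the length at the end drops the
-- pair of `n`.
descent ascent inverse : Program
descent = while (lit 1 << ` 5) (2 [ ` 5 ]≔ ` 3 ⨾ 3 ≔ ` 5 ⨾ fetch 5 3)
ascent  = while (` 3 << ` 0)
  (3 ≔⟨ 2 [ ` 3 ]⟩ ⨾ cond (` 6 << ` 3) (fetch 5 3 ⨾ store 6 (` 5) ⨾ 6 ≔ ` 3) skip)
inverse = 3 ≔ ` 0 ⨾ fetch 5 3 ⨾ descent ⨾ 6 ≔ ` 3 ⨾ ascent ⨾ 1 ≔pred ` 1

-- The path from n to x, recorded backwards from x by the pointers back.
data Trail (back g : ℕ → ℕ) (n : ℕ) : ℕ → List ℕ → Set where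
  []   : Trail back g n n []
  link : ∀ {x y st} → back x ≡ y → g y ≡ x → x < n → 2 ≤ y →
         Trail back g n y st → Trail back g n x (y ∷ st)

module _ {back g : ℕ → ℕ} {n : ℕ} where

  trail-≤ : ∀ {x st} → Trail back g n x st → x ≤ n
  trail-≤ []                 = ≤-refl
  trail-≤ (link _ _ x<n _ _) = <⇒≤ x<n

  trail-origin : ∀ {x st} → Trail back g n x st → n ∈ x ∷ st
  trail-origin []               = here refl
  trail-origin (link _ _ _ _ t) = there (trail-origin t)

  trail-unvisited : ∀ {x c v st} → c ∉ x ∷ st → Trail back g n x st →
                    Trail (back [ c ↦ v ]) g n x st
  trail-unvisited c∉ []                     = []
  trail-unvisited c∉ (link b e x<n 2≤y t) =
    link (trans (untouched back λ { refl → c∉ (here refl) }) b) e x<n 2≤y (trail-unvisited (c∉ ∘ there) t)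

  -- The bound is doubled to fit the shape of predicate expected by `1∉`.
  trail-path : ∀ {x y st} → 2 ≤ x → Trail back g n x st → y ∈ x ∷ st →
               ∃[ vs ] Path g y vs x × All (λ v → 2 ≤ v × 2 ≤ v) vs
  trail-path 2≤x t                     (here refl) = [] , [] , []
  trail-path 2≤x (link _ refl _ 2≤y t) (there y∈) with trail-path 2≤y t y∈
  ... | vs , p , vs≥2 = _ , p ++ᵖ (_ ∷ []) , All.++⁺ vs≥2 ((2≤y , 2≤y) ∷ [])

  -- Otherwise the trail would close a cycle avoiding 1, although 1 is reached from `x`. So
  -- recording the pointer of the next vertex overwrites no pointer of the trail.
  trail-fresh : ∀ {x st vs} → 2 ≤ x → Trail back g n x st → Path g (g x) vs 1 → g x ∉ x ∷ st
  trail-fresh 2≤x t p c∈ with trail-path 2≤x t c∈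
  ... | us , q , us≥2 = rooted⇒acyclic (_ ∷ q) (1∉ ((2≤x , 2≤x) ∷ us≥2)) (_ ∷ p)

-- Each vertex costs 6: the test, a write, a copy and the three instructions of `fetch`. The length
-- of the final trail is reported because it determines the cost of the ascent.
descent-runs : ∀ {n μ σ x st ps} → let g = arr σ 1 ∘ cell in
  var σ 3 ≡ x → var σ 5 ≡ g x → 2 ≤ x →
  Trail (arr σ 2) g n x st → Path g (g x) ps 1 → All (λ y → 2 ≤ y × y ≤ n) ps →
  Runs descent (length ps * 6 + suc μ) σ λ ν τ → ν ≡ μ
    × var τ 0 ≡ var σ 0 × var τ 1 ≡ var σ 1 × arr τ 0 ≡ arr σ 0 × arr τ 1 ≡ arr σ 1
    × ∃[ x′ ] ∃[ st′ ] var τ 3 ≡ x′ × 2 ≤ x′ × g x′ ≡ 1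
    × Trail (arr τ 2) g n x′ st′ × length st′ ≡ length ps + length st
descent-runs {σ = σ} {x} {st} {[]} x≡ c≡ 2≤x t p _ =
  halts (<ᵇ-false (≤-reflexive (trans c≡ (root p))))
    (refl , refl , refl , refl , refl , x , st , x≡ , 2≤x , root p , t , refl)
  where
  root : ∀ {y} → Path (arr σ 1 ∘ cell) y [] 1 → y ≡ 1
  root [] = refl
descent-runs {n} {μ} {σ} {x} {st} {c ∷ ps} refl c≡ 2≤x t p@(.c ∷ q) ((2≤c , c≤n) ∷ ps≤n) =
  loops (<ᵇ-true (subst (1 <_) (sym c≡) 2≤c)) $
  seqs $ writes $ seqs $ copies $ seqs $ decrements $ seqs $ decrements $ reads $
  conclude
    (descent-runs {n} {μ} {st = x ∷ st} c≡ (cong g c≡) 2≤c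
      (link (updated (arr σ 2) (sym c≡)) refl c<n 2≤x
        (subst (λ z → Trail (arr σ 2 [ z ↦ x ]) g n x st) (sym c≡) (trail-unvisited c∉ t)))
      q ps≤n)
    λ (eq , v0 , v1 , a0 , a1 , x′ , st′ , x≡ , 2≤x′ , r , t , l) →
      eq , v0 , v1 , a0 , a1 , x′ , st′ , x≡ , 2≤x′ , r , t , trans l (+-suc (length ps) (length st))
  where
  g = arr σ 1 ∘ cell
  c∉ : c ∉ x ∷ st
  c∉ = trail-fresh 2≤x t p
  -- The origin `n` is on the trail and `c` is not. Strictness lets the ascent recognise `n` by a
  -- comparison.
  c<n : c < n
  c<n = ≤∧≢⇒< c≤n λ { refl → c∉ (trail-origin t) }

rewired-cong : ∀ {f f′ g s ms} → (∀ {m} → m ∈ ms → f m ≡ f′ m) → Rewired f g s ms → Rewired f′ g s ms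
rewired-cong f≡f′ ([] eq)  = [] eq
rewired-cong f≡f′ (eq ∷ r) = trans eq (f≡f′ (here refl)) ∷ rewired-cong (f≡f′ ∘ there) r

-- ms are the right-to-left maxima found between x and 1, except the last
-- of them, m, whose value under f is not yet known.
ascent-runs : ∀ {g n μ σ x m st ms sg} → let f = arr σ 1 ∘ cell in
  var σ 0 ≡ n → var σ 3 ≡ x → var σ 6 ≡ m →
  Trail (arr σ 2) g n x st → 2 ≤ m → m ≤ n →
  Path g x sg m → All (λ y → 2 ≤ y × y ≤ m) sg →
  Layout g m ms → Rewired f g m ms → (∀ y → 2 ≤ y → y ∉ ms → g y ≡ f y) →
  Runs ascent (length st * 10 + suc μ) σ λ ν τ → ν ≡ μ × var τ 1 ≡ var σ 1 × arr τ 0 ≡ arr σ 0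
    × ∃[ ms′ ] Layout g n ms′ × Rewired (arr τ 1 ∘ cell) g n ms′
    × (∀ y → 2 ≤ y → y ∉ ms′ → g y ≡ arr τ 1 (cell y))
ascent-runs {n = n} {σ = σ} {m = m} {ms = ms} {sg} n≡ x≡ m≡ [] 2≤m m≤n p sg≤m l r kept =
  halts (<ᵇ-false (≤-reflexive (trans n≡ (sym x≡)))) (refl , refl , refl , finish (≤-antisym m≤n (n≤m p sg≤m)))
  where
  -- When the ascent ends, the pending maximum is `n` itself, since `n` is `m` or lies on the
  -- segment bounded by `m`.
  n≤m : ∀ {x sg} → Path _ x sg m → All (λ y → 2 ≤ y × y ≤ m) sg → x ≤ m
  n≤m []      _               = ≤-refl
  n≤m (_ ∷ _) ((_ , x≤m) ∷ _) = x≤m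
  finish : m ≡ n → _
  finish refl = ms , l , r , kept
ascent-runs {g} {n} {μ} {σ} {x} {m} {y ∷ st} {ms} {sg}
  n≡ x≡ m≡ (link b≡ e x<n 2≤y t) 2≤m m≤n p sg≤m l r kept =
  loops (<ᵇ-true (subst₂ _<_ (sym x≡) (sym n≡) x<n)) $ seqs $ reads $
  -- If `m < y`, then `y` is the maximum listed just before `m`, so `f m` is `g y`. The cell of `y`
  -- still holds this value because all overwritten cells belong to vertices below `m`.
  branches (m <? y) (cong₂ _<ᵇ_ m≡ y≡)
    (λ m<y →
      seqs $ seqs $ decrements $ seqs $ decrements $ reads $
      seqs $ seqs $ decrements $ seqs $ decrements $ writes $
      copies $
      ascent-runs {μ = μ} {st = st} {m ∷ ms} n≡ y≡ y≡ t 2≤y (trail-≤ t) [] []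
        (seg 2≤m m<y p′ sg≤m l)
        (trans (gy≡ m<y) (sym (updated (arr σ 1) (cong cell (sym m≡)))) ∷ rewired-cong elsewhere r)
        kept′)
    (λ m≮y → with-credit (s≤s (m≤n+m _ 6)) $ skips $
      ascent-runs {μ = μ} {st = st} {ms} n≡ y≡ m≡ t 2≤m m≤n (y ∷ p′) ((2≤y , ≮⇒≥ m≮y) ∷ sg≤m) l r kept)
  where
  y≡ : arr σ 2 (var σ 3) ≡ y
  y≡ = trans (cong (arr σ 2) x≡) b≡
  p′ : Path g (g y) sg m
  p′ = subst (λ z → Path g z sg m) (sym e) p
  gy≡ : m < y → g y ≡ arr σ 1 (cell (arr σ 2 (var σ 3)))
  gy≡ m<y = trans (kept y 2≤y λ y∈ → <-asym m<y (proj₂ (All.lookup (layout-< l) y∈)))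
    (cong (arr σ 1 ∘ cell) (sym y≡))
  other : ∀ {z v} → 2 ≤ z → z ≢ m → (arr σ 1 [ cell (var σ 6) ↦ v ]) (cell z) ≡ arr σ 1 (cell z)
  other 2≤z z≢m = untouched (arr σ 1) λ eq → z≢m (cell-injective 2≤z 2≤m (trans eq (cong cell m≡)))
  elsewhere : ∀ {z v} → z ∈ ms → arr σ 1 (cell z) ≡ (arr σ 1 [ cell (var σ 6) ↦ v ]) (cell z)
  elsewhere z∈ with All.lookup (layout-< l) z∈
  ... | 2≤z , z<m = sym (other 2≤z (<⇒≢ z<m))
  kept′ : ∀ {v} z → 2 ≤ z → z ∉ m ∷ ms → g z ≡ (arr σ 1 [ cell (var σ 6) ↦ v ]) (cell z)
  kept′ z 2≤z z∉ = trans (kept z 2≤z (z∉ ∘ there)) (sym (other 2≤z (z∉ ∘ here)))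

rewired-origin : ∀ {f g s ms i} → Rewired f g s ms → i ∈ ms → ∃[ j ] j ∈ s ∷ ms × f i ≡ g j
rewired-origin (eq ∷ _) (here refl) = _ , here refl , sym eq
rewired-origin (_ ∷ r)  (there i∈) with rewired-origin r i∈
... | j , j∈ , eq = j , there j∈ , eq

-- The inverse invents no values: at a maximum, `f` takes the value of `g` at some element of
-- `n ∷ ms`.
source-range : ∀ {f g N ms} → Rewired f g (2 + N) ms →
  All (λ m → 2 ≤ m × m < 2 + N) ms → (∀ y → 2 ≤ y → y ∉ ms → g y ≡ f y) →
  (∀ {x} → 2 ≤ x → x ≤ 2 + N → 1 ≤ g x × g x ≤ 2 + N) →
  ∀ {x} → 2 ≤ x → x ≤ suc N → 1 ≤ f x × f x ≤ 2 + N
source-range {N = N} {ms} rewired ms<n kept g-range {x} 2≤x x<n with x ∈? ms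
... | no  x∉ = subst (λ y → 1 ≤ y × y ≤ 2 + N) (kept x 2≤x x∉) (g-range 2≤x (<⇒≤ (s≤s x<n)))
... | yes x∈ with rewired-origin rewired x∈
...   | j , here refl , eq = subst (λ y → 1 ≤ y × y ≤ 2 + N) (sym eq) (g-range (s≤s (s≤s z≤n)) ≤-refl)
...   | j , there j∈  , eq with All.lookup ms<n j∈
...     | 2≤j , j<n = subst (λ y → 1 ≤ y × y ≤ 2 + N) (sym eq) (g-range 2≤j (<⇒≤ j<n))

Unwinds : (ℕ → ℕ) → ℕ → State → State → Set
Unwinds g n σ τ = var τ 1 ≡ pred (var σ 1) × arr τ 0 ≡ arr σ 0
  × ∃[ ms ] Layout g n ms × Rewired (arr τ 1 ∘ cell) g n ms
  × (∀ y → 2 ≤ y → y ∉ ms → g y ≡ arr τ 1 (cell y))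

inverse-runs : ∀ {N σ ps} → let n = 2 + N ; g = arr σ 1 ∘ cell in
  var σ 0 ≡ n → Path g (g n) ps 1 → All (λ y → 2 ≤ y × y ≤ n) ps → length ps ≤ n →
  Runs inverse (20 * n) σ λ _ → Unwinds g n σ
inverse-runs {N} {σ} {ps} n≡ p ps≤n l≤n = with-credit enough $
  seqs $ copies $ seqs $ seqs $ decrements $ seqs $ decrements $ reads $
  seqs $ conclude (descent-runs {n} {st = []} n≡ (cong g n≡) 2≤n [] p ps≤n)
  λ { (refl , v0 , v1 , a0 , a1 , x , st , x≡ , 2≤x , gx≡1 , t , l≡) →
    seqs $ copies $ seqs $
    with-credit (+-monoˡ-≤ 2 (*-monoˡ-≤ 10 (≤-reflexive (trans l≡ (+-identityʳ (length ps)))))) $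
    conclude (ascent-runs {μ = 1} (trans v0 n≡) x≡ x≡ t 2≤x (trail-≤ t) [] [] ([] gx≡1) ([] gx≡1)
               λ y _ _ → cong (λ a → a (cell y)) (sym a1))
    λ { (refl , w1 , b0 , ms , l , r , kept) →
      decrements (cong pred (trans w1 v1) , trans b0 a0 , ms , l , r , kept) } }
  where
  n = 2 + N
  g = arr σ 1 ∘ cell
  2≤n : 2 ≤ n
  2≤n = s≤s (s≤s z≤n)
  -- Each vertex of `ps` costs 6 on the way down and 10 on the way back; the fixed cost 8 is at most
  -- `4 * n` because `2 ≤ n`.
  enough : 4 + (length ps * 6 + suc (suc (length ps * 10 + 2))) ≤ 20 * n
  enough = begin
    4 + (length ps * 6 + suc (suc (length ps * 10 + 2))) ≡⟨ total (length ps) ⟩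
    4 * 2 + 16 * length ps                               ≤⟨ +-mono-≤ (*-monoʳ-≤ 4 2≤n) (*-monoʳ-≤ 16 l≤n) ⟩
    4 * n + 16 * n                                       ≡⟨ *-distribʳ-+ n 4 16 ⟨
    20 * n                                               ∎
    where
    open ≤-Reasoning
    total : ∀ l → 4 + (l * 6 + suc (suc (l * 10 + 2))) ≡ 4 * 2 + 16 * l
    total = solve-∀

inverse-output : ∀ {N t} (T : C⃗ (2 + N)) → let σ = input (2 + N) (pairs (parent T)) in
  Runs inverse t σ (λ _ → Unwinds (code (parent T)) (2 + N) σ) →
  ∃[ f ] IsΘ f T × (∀ f′ → IsΘ f′ T → f′ ≗ f)
    × (inverse on⟨ 2 + N , pairs (parent T) ⟩outputs pairs f within t)
inverse-output {N} T (runs {τ} {k} e k≤ (v1 , a0 , ms , layout , rewired , kept)) =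
  f , isΘ⇐ {f = f} repF {T} repG data′ , Θ-injective {f = f} {T} repF repG data′
    , τ , k , e
    , output-pairs f τ repF (trans v1 (cong pred (length-pairs (parent T)))) first (λ _ → refl)
    , m+n≤o⇒m≤o k k≤
  where
  n = 2 + N
  g = code (parent T)
  repG = code-represents (parent T)
  F = arr τ 1 ∘ cell

  F-range : ∀ {x} → 2 ≤ x → x ≤ suc N → 1 ≤ F x × F x ≤ n
  F-range = source-range rewired (layout-< layout) kept (range {h = parent T} repG)

  f : 𝓕 n
  f = restrict F F-range

  repF : Represents f F
  repF _ = refl

  kept′ : ∀ {y} → 2 ≤ y → y < n → y ∉ ms → g y ≡ F y
  kept′ 2≤y _ = kept _ 2≤y

  descends : ∀ {x} → 2 ≤ x → x < n → ∃[ vs ] Path g x vs 1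
  descends {x} 2≤x x<n with star⇒path {h = parent T} repG (rooted T (⟪ x ⟫ {<⇒≤ 2≤x} {<⇒≤ x<n}))
  ... | vs , q , _ = vs , q

  data′ : ΘData F g n ms
  data′ = record
    { decreasing = layout-decreasing layout
    ; sound      = layout-sound rewired kept′ layout descends
    ; complete   = layout-complete rewired kept′ layout descends
    ; rewired    = rewired
    ; kept       = kept′
    }

  first : ∀ {i} → i < N → arr τ 0 i ≡ 2 + i
  first {i} i<N = trans (cong (λ a → a i) a0)
    (cong proj₁ (entry-pairs (parent T) (⟪ 2 + i ⟫ {s≤s (s≤s z≤n)} {s≤s (s≤s (<⇒≤ i<N))}) refl))

inverse-correct : ∀ N (T : C⃗ (2 + N)) →
  ∃[ f ] IsΘ f T × (∀ f′ → IsΘ f′ T → f′ ≗ f)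
    × (inverse on⟨ 2 + N , pairs (parent T) ⟩outputs pairs f within 20 * (2 + N))
inverse-correct N T = from-root
  (star⇒path {h = parent T} (code-represents (parent T)) (rooted T (⟪ 2 + N ⟫ {s≤s z≤n} {≤-refl})))
  where
  from-root : ∃[ vs ] Path (code (parent T)) (2 + N) vs 1 × All (λ v → 2 ≤ v × v ≤ 2 + N) vs → _
  from-root (_ , (_ ∷ p) , n≤n ∷ ps≤n) = inverse-output T (inverse-runs {N} refl p ps≤n
    (s≤s⁻¹ (length≤ (unique (_ ∷ p) (1∉ (n≤n ∷ ps≤n))) (All.map (s≤s ∘ proj₂) (n≤n ∷ ps≤n)))))

-- Finding the cycle maxima

Interior : ℕ → ℕ → Set
Interior n y = 2 ≤ y × y < n

-- From a vertex on a cycle the target can only be a mark, which makes the marks complete; for all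
-- vertices together it gives rootedness of the tree.
Settled : (f : ℕ → ℕ) (n : ℕ) (mark : ℕ → ℕ) → ℕ → Set
Settled f n mark y =
  ∃[ vs ] ∃[ z ] Path f y vs z × All (Interior n) vs × (z ≡ 1 ⊎ z ≡ n ⊎ mark z ≢ 0)

-- The walk from i has coloured vs; ds lists all coloured vertices
-- other than 1 and n.
record Colouring (f : ℕ → ℕ) (n : ℕ) (mark colour : ℕ → ℕ) (i : ℕ) (ds vs : List ℕ) : Set where
  field
    distinct : Unique ds
    interior : All (Interior n) ds
    coloured : All (λ y → colour y ≢ 0) ds
    one      : colour 1 ≢ 0
    top      : colour n ≢ 0
    sound    : ∀ {m} → mark m ≢ 0 → CycleMaximum f n m
    settled  : ∀ {y} → colour y ≢ 0 → y ∈ vs ⊎ Settled f n mark y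
    seen     : ∀ {y} → i < y → y < n → colour y ≢ 0
    walked   : ∀ {y} → y ∈ vs → colour y ≡ i
    old      : ∀ y → colour y < 2 ⊎ i ≤ colour y
    own      : ∀ {y} → 2 ≤ i → colour y ≡ i → y ∈ vs

module _ {f : ℕ → ℕ} {n : ℕ} {mark colour : ℕ → ℕ} {i : ℕ} {ds vs : List ℕ}
         (col : Colouring f n mark colour i ds vs) where

  open Colouring col

  -- Since 1 and `n` are coloured in advance they end every walk, so a walk only looks up `f` where
  -- it is defined.
  uncoloured-interior : ∀ {x} → 1 ≤ x → x ≤ n → colour x ≡ 0 → Interior n x
  uncoloured-interior 1≤x x≤n x≡0 =
    ≤∧≢⇒< 1≤x (λ { refl → one x≡0 }) , ≤∧≢⇒< x≤n (λ { refl → top x≡0 })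

  colour-step : ∀ {x} → 2 ≤ i → Interior n x → colour x ≡ 0 →
                Colouring f n mark (colour [ x ↦ i ]) i (x ∷ ds) (vs ∷ʳ x)
  colour-step {x} 2≤i x-int x≡0 = record
    { distinct = All.map (λ y≢0 x≡y → y≢0 (trans (cong colour (sym x≡y)) x≡0)) coloured ∷ distinct
    ; interior = x-int ∷ interior
    ; coloured = x≢0′ ∷ All.map keep coloured
    ; one      = keep one
    ; top      = keep top
    ; sound    = sound
    ; settled  = settled′
    ; seen     = λ i<y y<n → keep (seen i<y y<n)
    ; walked   = walked′
    ; old      = old′
    ; own      = own′
    }
    where
    i≢0 : i ≢ 0
    i≢0 i≡0 = n≮0 (subst (1 <_) i≡0 2≤i)
    x≢0′ : (colour [ x ↦ i ]) x ≢ 0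
    x≢0′ eq = i≢0 (trans (sym (updated colour refl)) eq)
    keep : ∀ {y} → colour y ≢ 0 → (colour [ x ↦ i ]) y ≢ 0
    keep {y} y≢0 with y ≟ x
    ... | yes refl = x≢0′
    ... | no  y≢x  = y≢0 ∘ trans (sym (untouched colour y≢x))
    settled′ : ∀ {y} → (colour [ x ↦ i ]) y ≢ 0 → y ∈ vs ∷ʳ x ⊎ Settled f n mark y
    settled′ {y} y≢0 with y ≟ x
    ... | yes refl = inj₁ (∈-++⁺ʳ vs (here refl))
    ... | no  y≢x with settled (y≢0 ∘ trans (untouched colour y≢x))
    ...   | inj₁ y∈ = inj₁ (∈-++⁺ˡ y∈)
    ...   | inj₂ s  = inj₂ s
    walked′ : ∀ {y} → y ∈ vs ∷ʳ x → (colour [ x ↦ i ]) y ≡ i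
    walked′ {y} y∈ with y ≟ x | ∈-++⁻ vs y∈
    ... | yes refl | _                = updated colour refl
    ... | no  y≢x  | inj₁ y∈vs        = trans (untouched colour y≢x) (walked y∈vs)
    ... | no  y≢x  | inj₂ (here y≡x) = contradiction y≡x y≢x
    old′ : ∀ y → (colour [ x ↦ i ]) y < 2 ⊎ i ≤ (colour [ x ↦ i ]) y
    old′ y with y ≟ x
    ... | yes refl = inj₂ (≤-reflexive (sym (updated colour refl)))
    ... | no  y≢x  = subst (λ c → c < 2 ⊎ i ≤ c) (sym (untouched colour y≢x)) (old y)
    own′ : ∀ {y} → 2 ≤ i → (colour [ x ↦ i ]) y ≡ i → y ∈ vs ∷ʳ x
    own′ {y} 2≤i y≡i with y ≟ x
    ... | yes refl = ∈-++⁺ʳ vs (here refl)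
    ... | no  y≢x  = ∈-++⁺ˡ (own 2≤i (trans (sym (untouched colour y≢x)) y≡i))

  length-coloured : length ds ≤ n
  length-coloured = length≤ distinct (All.map proj₂ interior)

module _ {f : ℕ → ℕ} {n : ℕ} {mark colour : ℕ → ℕ} {i : ℕ} {ds vs : List ℕ}
         (col : Colouring f n mark colour (suc i) ds vs)
  where

  open Colouring col

  start-coloured : ∀ {x} → Path f (suc i) vs x → colour x ≢ 0 → colour (suc i) ≢ 0
  start-coloured p x≢0 with first∈ p
  ... | here refl = x≢0
  ... | there i∈  = λ i≡0 → 1+n≢0 (trans (sym (walked i∈)) i≡0)

  colour-close : colour (suc i) ≢ 0 → ∀ {mark′} → (∀ {z} → mark z ≢ 0 → mark′ z ≢ 0) →
    (∀ {m} → mark′ m ≢ 0 → CycleMaximum f n m) → (∀ {y} → y ∈ vs → Settled f n mark′ y) →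
    Colouring f n mark′ colour i ds []
  colour-close i≢0 {mark′} marks sound′ settled′ = record
    { distinct = distinct
    ; interior = interior
    ; coloured = coloured
    ; one      = one
    ; top      = top
    ; sound    = sound′
    ; settled  = inj₂ ∘ settle
    ; seen     = seen′
    ; walked   = λ ()
    ; old      = old′
    ; own      = own′
    }
    where
    settle : ∀ {y} → colour y ≢ 0 → Settled f n mark′ y
    settle y≢0 with settled y≢0
    ... | inj₁ y∈ = settled′ y∈
    ... | inj₂ (_ , _ , p , int , inj₁ z≡1)        = _ , _ , p , int , inj₁ z≡1
    ... | inj₂ (_ , _ , p , int , inj₂ (inj₁ z≡n)) = _ , _ , p , int , inj₂ (inj₁ z≡n)
    ... | inj₂ (_ , _ , p , int , inj₂ (inj₂ z≢0)) = _ , _ , p , int , inj₂ (inj₂ (marks z≢0))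
    seen′ : ∀ {y} → i < y → y < n → colour y ≢ 0
    seen′ i<y y<n with m≤n⇒m<n∨m≡n i<y
    ... | inj₁ i+1<y = seen i+1<y y<n
    ... | inj₂ refl  = i≢0
    old′ : ∀ y → colour y < 2 ⊎ i ≤ colour y
    old′ y with old y
    ... | inj₁ y<2 = inj₁ y<2
    ... | inj₂ i<y = inj₂ (<⇒≤ i<y)
    -- Starts decrease, so the colours of earlier walks exceed `i`, and all other colours are below
    -- 2: no vertex has colour `i` when the walk from `i` begins.
    own′ : ∀ {y} → 2 ≤ i → colour y ≡ i → y ∈ []
    own′ {y} 2≤i refl with old y
    ... | inj₁ y<2 = contradiction 2≤i (<⇒≱ y<2)
    ... | inj₂ i<i = contradiction i<i (<-irrefl refl)

  module _ (i≢0 : colour (suc i) ≢ 0) {x} (p : Path f (suc i) vs x) (int : All (Interior n) vs) where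

    tail-path : ∀ {y} → y ∈ vs → ∃[ ws ] Path f y ws x × All (Interior n) ws
    tail-path {y} y∈ with split p y∈
    ... | as , bs , _ , q , refl = y ∷ bs , y ∷ q , All.++⁻ʳ as int

    settle-via : ∀ {mark′} → Settled f n mark′ x → ∀ {y} → y ∈ vs → Settled f n mark′ y
    settle-via (us , z , q , us-int , target) y∈ with tail-path y∈
    ... | ws , r , ws-int = ws ++ us , z , r ++ᵖ q , All.++⁺ ws-int us-int , target

    -- The walk ran into an older vertex, and every walked vertex inherits its target.
    colour-settled : x ∉ vs → colour x ≢ 0 → Colouring f n mark colour i ds []
    colour-settled x∉ x≢0 with settled x≢0
    ... | inj₁ x∈ = contradiction x∈ x∉
    ... | inj₂ s  = colour-close i≢0 id sound (settle-via s)

    -- Every walked vertex leads to `x` and on around the cycle to `m`, whose new mark settles it.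
    colour-cycle : ∀ {m ws} → x ∈ vs → Path f (f x) ws x → All (Interior n) (x ∷ ws) →
      m ∈ x ∷ ws → All (_≤ m) (x ∷ ws) → Colouring f n (mark [ m ↦ 1 ]) colour i ds []
    colour-cycle {m} {ws} x∈ c c-int m∈ ≤m = colour-close i≢0 marks sound′ (settle-via x-settled)
      where
      m-marked : (mark [ m ↦ 1 ]) m ≢ 0
      m-marked eq with () ← trans (sym (updated mark {m} refl)) eq
      marks : ∀ {z} → mark z ≢ 0 → (mark [ m ↦ 1 ]) z ≢ 0
      marks {z} z≢0 with z ≟ m
      ... | yes refl = m-marked
      ... | no  z≢m  = z≢0 ∘ trans (sym (untouched mark z≢m))
      sound′ : ∀ {z} → (mark [ m ↦ 1 ]) z ≢ 0 → CycleMaximum f n z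
      sound′ {z} z≢0 with z ≟ m
      ... | yes refl = cycle⇒maximum c c-int m∈ ≤m
      ... | no  z≢m  = sound (z≢0 ∘ trans (untouched mark z≢m))
      x-settled : Settled f n (mark [ m ↦ 1 ]) x
      x-settled with split (x ∷ c) m∈
      ... | as , bs , q , _ , eq =
        as , m , q , All.++⁻ˡ as (subst (All (Interior n)) eq c-int) , inj₂ (inj₂ m-marked)

-- Variable 2 is the start of the walk and its colour, 3 the current vertex, 5 its colour.
-- `circling` reuses 5 as a stop flag, while 7 runs around the cycle and 6 keeps the largest vertex
-- met. Array 2 holds the colours, array 3 the marks.
walk circling circle search : Program
walk     = while (` 5 == lit 0) (2 [ ` 3 ]≔ ` 2 ⨾ fetch 3 3 ⨾ 5 ≔⟨ 2 [ ` 3 ]⟩)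
circling = while (` 5 == lit 0)
  (cond (` 7 == ` 3) (5 ≔ lit 1) (cond (` 6 << ` 7) (6 ≔ ` 7) skip ⨾ fetch 7 7))
circle   = 6 ≔ ` 3 ⨾ fetch 7 3 ⨾ 5 ≔ lit 0 ⨾ circling ⨾ 3 [ ` 6 ]≔ lit 1
search   = while (lit 2 << ` 2)
  (2 ≔pred ` 2 ⨾ 3 ≔ ` 2 ⨾ 5 ≔⟨ 2 [ ` 3 ]⟩ ⨾ walk ⨾ cond (` 5 == ` 2) circle skip)

-- A round costs 7: three tests, a copy or `skip`, and `fetch`. The closing round, with the failing
-- loop test, costs 4.
circling-runs : ∀ {μ σ y m ws} → let x = var σ 3 ; f = arr σ 1 ∘ cell in
  var σ 5 ≡ 0 → var σ 7 ≡ y → var σ 6 ≡ m → Path f y ws x → x ∉ ws →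
  Runs circling (length ws * 7 + (4 + μ)) σ λ ν τ → ν ≡ μ
    × var τ 0 ≡ var σ 0 × var τ 1 ≡ var σ 1 × var τ 2 ≡ var σ 2 × arr τ ≡ arr σ
    × var τ 6 ∈ m ∷ ws × All (_≤ var τ 6) (m ∷ ws)
circling-runs {μ} {σ} {y} {m} {[]} c≡ y≡ refl p x∉ =
  loops (≡ᵇ-true c≡) $ thens (≡ᵇ-true (trans y≡ (end p))) $ copies $ halts refl
    (refl , refl , refl , refl , refl , here refl , ≤-refl ∷ [])
  where
  end : ∀ {f : ℕ → ℕ} {y z} → Path f y [] z → y ≡ z
  end [] = refl
circling-runs {μ} {σ} {y} {m} {.y ∷ ws} c≡ refl refl (.y ∷ p) x∉ =
  loops (≡ᵇ-true c≡) $ elses (≡ᵇ-false (x∉ ∘ here ∘ sym)) $ seqs $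
  branches (m <? y) refl
    (λ m<y → copies $
      seqs $ decrements $ seqs $ decrements $ reads $
      conclude (circling-runs {μ} {ws = ws} c≡ refl refl p (x∉ ∘ there))
      λ { (ν≡ , v0 , v1 , v2 , as , t∈ , y≤t ∷ ws≤t) →
          ν≡ , v0 , v1 , v2 , as , there t∈ , ≤-trans (<⇒≤ m<y) y≤t ∷ y≤t ∷ ws≤t })
    (λ m≮y → skips $
      seqs $ decrements $ seqs $ decrements $ reads $
      conclude (circling-runs {μ} {ws = ws} c≡ refl refl p (x∉ ∘ there))
      λ { (ν≡ , v0 , v1 , v2 , as , t∈ , m≤t ∷ ws≤t) →
          ν≡ , v0 , v1 , v2 , as , skip-y t∈ , m≤t ∷ ≤-trans (≮⇒≥ m≮y) m≤t ∷ ws≤t })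
  where
  skip-y : ∀ {t} → t ∈ m ∷ ws → t ∈ m ∷ y ∷ ws
  skip-y (here eq)  = here eq
  skip-y (there t∈) = there (there t∈)

circle-runs : ∀ {μ σ x ws} → let f = arr σ 1 ∘ cell in
  var σ 3 ≡ x → Path f (f x) ws x → x ∉ ws →
  Runs circle (10 + length ws * 7 + μ) σ λ ν τ → ν ≡ μ
    × var τ 0 ≡ var σ 0 × var τ 1 ≡ var σ 1 × var τ 2 ≡ var σ 2
    × arr τ 0 ≡ arr σ 0 × arr τ 1 ≡ arr σ 1 × arr τ 2 ≡ arr σ 2
    × ∃[ m ] arr τ 3 ≡ arr σ 3 [ m ↦ 1 ] × m ∈ x ∷ ws × All (_≤ m) (x ∷ ws)
circle-runs {μ} {σ} {x} {ws} refl p x∉ = with-credit (≤-reflexive (total (length ws) μ)) $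
  seqs $ copies $ seqs $ seqs $ decrements $ seqs $ decrements $ reads $ seqs $ copies $ seqs $
  conclude (circling-runs {suc μ} {ws = ws} refl refl refl p x∉)
  λ { {τ = τ} (refl , v0 , v1 , v2 , as , m∈ , ≤m) → writes
    (refl , v0 , v1 , v2 , cong (λ a → a 0) as , cong (λ a → a 1) as , cong (λ a → a 2) as
    , var τ 6 , cong (λ a → a 3 [ var τ 6 ↦ 1 ]) as , m∈ , ≤m) }
  where
  total : ∀ l μ → 5 + (l * 7 + (4 + suc μ)) ≡ 10 + l * 7 + μ
  total = solve-∀

module _ {n ℓ : ℕ} {a₀ a : ℕ → ℕ}
         (f-range : ∀ {y} → Interior n y → 1 ≤ a (cell y) × a (cell y) ≤ n) where

  private f = a ∘ cell

  Setting : ℕ → State → Set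
  Setting i σ = var σ 0 ≡ n × var σ 1 ≡ ℓ × var σ 2 ≡ i × arr σ 0 ≡ a₀ × arr σ 1 ≡ a

  -- `r` bounds the number of vertices still uncoloured, each holding 13 credits: 6 pay for the step
  -- that colours it, and 7 stay with it, as the 7 per element of `vs`, for a possible turn around
  -- its cycle.
  Walked : ℕ → ℕ → ℕ → State → Set
  Walked i μ ν τ = ∃[ x ] ∃[ vs ] ∃[ ds ] ∃[ r ]
    var τ 3 ≡ x × var τ 5 ≡ arr τ 2 x × arr τ 2 x ≢ 0
    × Colouring f n (arr τ 3) (arr τ 2) i ds vs
    × Path f i vs x × All (Interior n) vs
    × length ds + r ≡ n × ν ≡ r * 13 + (length vs * 7 + μ)

  walk-runs : ∀ r {μ σ i x vs ds} → 2 ≤ i → Setting i σ →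
    var σ 3 ≡ x → var σ 5 ≡ arr σ 2 x → 1 ≤ x → x ≤ n →
    Colouring f n (arr σ 3) (arr σ 2) i ds vs →
    Path f i vs x → All (Interior n) vs → length ds + r ≡ n →
    Runs walk (r * 13 + (length vs * 7 + suc μ)) σ λ ν τ → Setting i τ × Walked i μ ν τ
  walk-runs r {μ} {σ} {i} {x} {vs} {ds} 2≤i s@(v0 , v1 , refl , b0 , b1) refl c≡ 1≤x x≤n col p int budget
    with arr σ 2 x ≟ 0
  ... | no x≢0 = with-credit (≤-reflexive (exit r (length vs) μ)) $
    halts (≡ᵇ-false (x≢0 ∘ trans (sym c≡)))
      (s , x , vs , ds , r , refl , c≡ , x≢0 , col , p , int , budget , refl)
    where
    exit : ∀ r l μ → suc (r * 13 + (l * 7 + μ)) ≡ r * 13 + (l * 7 + suc μ)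
    exit = solve-∀
  walk-runs zero {σ = σ} {i} {x} {vs} {ds} 2≤i (_ , _ , refl , _) refl c≡ 1≤x x≤n col p int budget
    | yes x≡0 =
      contradiction (length-coloured col′) (<⇒≱ (s≤s (≤-reflexive (trans (sym budget) (+-identityʳ (length ds))))))
    where
    col′ = colour-step col 2≤i (uncoloured-interior col 1≤x x≤n x≡0) x≡0
  walk-runs (suc r) {μ} {σ} {i} {x} {vs} {ds} 2≤i (v0 , v1 , refl , b0 , b1) refl c≡ 1≤x x≤n col p int budget
    | yes x≡0 =
    loops (≡ᵇ-true (trans c≡ x≡0)) $
    seqs $ writes $ seqs $ seqs $ decrements $ seqs $ decrements $ reads $ reads $
    with-credit (≤-reflexive (trans
      (cong (λ l → r * 13 + (l * 7 + suc μ)) (length-++ vs)) (step r (length vs) μ))) $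
    walk-runs r {μ} 2≤i (v0 , v1 , refl , b0 , b1) (cong (λ b → b (cell x)) b1)
      (cong (λ b → (arr σ 2 [ x ↦ i ]) (b (cell x))) b1)
      (proj₁ (f-range x-int)) (proj₂ (f-range x-int))
      (colour-step col 2≤i x-int x≡0)
      (p ++ᵖ (x ∷ [])) (All.++⁺ int (x-int ∷ [])) (trans (sym (+-suc (length ds) r)) budget)
    where
    x-int = uncoloured-interior col 1≤x x≤n x≡0
    step : ∀ r l μ → r * 13 + ((l + 1) * 7 + suc μ) ≡ 7 + (r * 13 + (l * 7 + suc μ))
    step = solve-∀

  -- A start costs 16: its own four instructions, the failing test that ends the walk, and 11 for
  -- the branch and the fixed part of `circle`. The loop variable is one ahead of the next start
  -- because it is lowered before use.
  search-runs : ∀ j {μ σ ds r} → Setting (2 + j) σ → 2 + j ≤ n →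
    Colouring f n (arr σ 3) (arr σ 2) (suc j) ds [] → length ds + r ≡ n →
    Runs search (j * 16 + (r * 13 + suc μ)) σ λ ν τ → ν ≡ μ
      × Setting 2 τ × ∃[ ds′ ] Colouring f n (arr τ 3) (arr τ 2) 1 ds′ []
  search-runs zero {r = r} s@(_ , _ , v2 , _) _ col _ = with-credit (m≤n+m _ (r * 13)) $
    halts (<ᵇ-false (≤-reflexive v2)) (refl , s , _ , col)
  search-runs (suc j) {μ} {σ} {ds} {r} (v0 , v1 , v2 , b0 , b1) 3+j≤n col budget =
    with-credit (≤-reflexive (sym (arrange j r μ))) $
    loops (<ᵇ-true (subst (2 <_) (sym v2) (s≤s (s≤s (s≤s z≤n))))) $
    seqs $ decrements $ seqs $ copies $ seqs $ reads $ seqs $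
    conclude (walk-runs r {11 + (j * 16 + suc μ)} {vs = []} (s≤s (s≤s z≤n))
      (v0 , v1 , i≡ , b0 , b1) i≡ (cong (arr σ 2) i≡) (s≤s z≤n) (<⇒≤ 3+j≤n) col [] [] budget)
    finish
    where
    i = 2 + j
    i≡ : pred (var σ 2) ≡ i
    i≡ = cong pred v2
    arrange : ∀ j r μ → suc j * 16 + (r * 13 + suc μ) ≡ 4 + (r * 13 + suc (11 + (j * 16 + suc μ)))
    arrange = solve-∀

    Next : ℕ → State → Set
    Next ν τ = Runs search ν τ λ ν τ → ν ≡ μ
      × Setting 2 τ × ∃[ ds′ ] Colouring f n (arr τ 3) (arr τ 2) 1 ds′ []

    finish : ∀ {ν τ} → Setting i τ × Walked i (11 + (j * 16 + suc μ)) ν τ →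
             Runs (cond (` 5 == ` 2) circle skip) ν τ Next
    finish {τ = τ} ((v0 , v1 , v2 , b0 , b1) , x , vs , ds , r , x≡ , c≡ , x≢0 , col , p , int , budget , refl)
      with arr τ 2 x ≟ i
    ... | no x≢i = with-credit (≤-trans (m≤m+n _ _) (≤-reflexive (sym (skip-credit j r (length vs) μ)))) $
      elses (≡ᵇ-false λ eq → x≢i (trans (sym c≡) (trans eq v2))) $ skips $
      search-runs j (v0 , v1 , v2 , b0 , b1) (<⇒≤ 3+j≤n)
        (colour-settled col (start-coloured col p x≢0) p int (λ x∈ → x≢i (Colouring.walked col x∈)) x≢0) budget
      where
      skip-credit : ∀ j r l μ → r * 13 + (l * 7 + (11 + (j * 16 + suc μ)))
                              ≡ 2 + (j * 16 + (r * 13 + suc μ)) + (l * 7 + 9)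
      skip-credit = solve-∀
    -- The walk ended in its own colour, so it had passed `x` before and runs from there around a
    -- cycle. This cycle is no longer than the walk, whose saved credits pay for `circle`.
    ... | yes x≡i with Colouring.own col (s≤s (s≤s z≤n)) x≡i
    ...   | x∈ with split p x∈
    ...     | as , bs , _ , q , refl with truncate q
    ...       | ws , us , refl , c , x∉ = with-credit circle-credit $
      thens (≡ᵇ-true (trans c≡ (trans x≡i (sym v2)))) $
      conclude (circle-runs x≡ (subst (λ b → Path (b ∘ cell) (b (cell x)) ws x) (sym b1) c) x∉)
      λ { (refl , w0 , w1 , w2 , d0 , d1 , d2 , m , d3 , m∈ , ≤m) →
        search-runs j (trans w0 v0 , trans w1 v1 , trans w2 v2 , trans d0 b0 , trans d1 b1) (<⇒≤ 3+j≤n)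
          (subst₂ (λ mark colour → Colouring f n mark colour (suc j) ds []) (sym d3) (sym d2)
            (colour-cycle col (start-coloured col p x≢0) p int x∈ c
              (All.++⁻ˡ (x ∷ ws) (All.++⁻ʳ as int)) m∈ ≤m))
          budget }
      where
      rearrange : ∀ l y z μ → suc (10 + l * 7 + (y + (z + suc μ))) ≡ z + (l * 7 + (11 + (y + suc μ)))
      rearrange = solve-∀
      ws≤ : length ws ≤ length (as ++ x ∷ ws ++ us)
      ws≤ = begin
        length ws                     ≤⟨ m≤m+n _ _ ⟩
        length ws + length us         ≡⟨ length-++ ws ⟨
        length (ws ++ us)             ≤⟨ n≤1+n _ ⟩
        length (x ∷ ws ++ us)         ≤⟨ m≤n+m _ _ ⟩
        length as + length (x ∷ ws ++ us) ≡⟨ length-++ as ⟨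
        length (as ++ x ∷ ws ++ us)   ∎
        where open ≤-Reasoning
      circle-credit : suc (10 + length ws * 7 + (j * 16 + (r * 13 + suc μ)))
                    ≤ r * 13 + (length (as ++ x ∷ ws ++ us) * 7 + (11 + (j * 16 + suc μ)))
      circle-credit = ≤-trans (≤-reflexive (rearrange (length ws) (j * 16) (r * 13) μ))
        (+-monoʳ-≤ (r * 13) (+-monoˡ-≤ (11 + (j * 16 + suc μ)) (*-monoˡ-≤ 7 ws≤)))

-- Computing Θ

unmarked? : (mark : ℕ → ℕ) → Decidable (λ m → mark m ≢ 0)
unmarked? mark m = ¬? (mark m ≟ 0)

-- These are, in order, the vertices that `relink` has yet to treat when its loop variable is
-- `2 + j`.
marked : (ℕ → ℕ) → ℕ → List ℕ
marked mark j = filter (unmarked? mark) (applyDownFrom (2 +_) j)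

module _ {mark : ℕ → ℕ} where

  marked⁻ : ∀ {j m} → m ∈ marked mark j → Interior (2 + j) m × mark m ≢ 0
  marked⁻ {j} m∈ with ∈-filter⁻ (unmarked? mark) {xs = applyDownFrom (2 +_) j} m∈
  ... | m∈′ , m≢0 with ∈-applyDownFrom⁻ (2 +_) m∈′
  ...   | i , i<j , refl = (s≤s (s≤s z≤n) , s≤s (s≤s i<j)) , m≢0

  marked⁺ : ∀ {j m} → Interior (2 + j) m → mark m ≢ 0 → m ∈ marked mark j
  marked⁺ (s≤s (s≤s _) , s≤s (s≤s i<j)) m≢0 =
    ∈-filter⁺ (unmarked? mark) (∈-applyDownFrom⁺ (2 +_) i<j) m≢0

  marked-decreasing : ∀ j → Linked _>_ (2 + j ∷ marked mark j)
  marked-decreasing j = Linked.∷-filter⁺ (unmarked? mark) (λ x>y y>z → <-trans y>z x>y)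
    (Linked.applyDownFrom⁺₂ (2 +_) (suc j) λ _ → ≤-refl)

relink : Program
relink = while (lit 2 << ` 2)
  (2 ≔pred ` 2 ⨾ 5 ≔⟨ 3 [ ` 2 ]⟩ ⨾
   cond (` 5 == lit 0) skip (fetch 5 2 ⨾ store 6 (` 5) ⨾ store 2 (lit 1) ⨾ 6 ≔ ` 2))

Relinked : (ℕ → ℕ) → ℕ → List ℕ → State → ℕ → ℕ → State → Set
Relinked f s ms σ μ ν τ = ν ≡ μ
    × var τ 0 ≡ var σ 0 × var τ 1 ≡ var σ 1 × arr τ 0 ≡ arr σ 0
    × Rewired f (arr τ 1 ∘ cell) s ms
    × (∀ y → 2 ≤ y → y ∉ s ∷ ms → arr τ 1 (cell y) ≡ arr σ 1 (cell y))

-- The cell of the last treated `s` always holds 1, a provisional edge to the root. So neither the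
-- last maximum nor the absence of cycles is a special case. Below the loop variable the array still
-- holds `f`.
relink-runs : ∀ j {f μ σ s ms} → ms ≡ marked (arr σ 3) j →
  var σ 2 ≡ 2 + j → var σ 6 ≡ s → 2 + j ≤ s → arr σ 1 (cell s) ≡ 1 →
  (∀ k → k < j → arr σ 1 k ≡ f (2 + k)) →
  Runs relink (j * 14 + suc μ) σ (Relinked f s ms σ μ)
relink-runs zero refl i≡ _ _ s≡1 _ =
  halts (<ᵇ-false (≤-reflexive i≡)) (refl , refl , refl , refl , [] s≡1 , λ _ _ _ → refl)
relink-runs (suc j) {f} {μ} {σ} {s} {ms} ms≡ i≡ refl i<s s≡1 A≡f =
  loops (<ᵇ-true (subst (2 <_) (sym i≡) (s≤s (s≤s (s≤s z≤n))))) $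
  seqs $ decrements $ seqs $ reads $
  branches (arr σ 3 i ≟ 0) (cong (λ i → arr σ 3 i ≡ᵇ 0) i≡′) unchanged exchange
  where
  i = 2 + j
  A = arr σ 1
  i≡′ : pred (var σ 2) ≡ i
  i≡′ = cong pred i≡
  s≥2 : 2 ≤ s
  s≥2 = ≤-trans (s≤s (s≤s z≤n)) i<s
  s∉ : s ∉ i ∷ marked (arr σ 3) j
  s∉ (here s≡i) = <-irrefl (sym s≡i) i<s
  s∉ (there s∈) = <-asym i<s (proj₂ (proj₁ (marked⁻ {j = j} s∈)))
  swap : ℕ → ℕ → ℕ
  swap i′ = (A [ cell s ↦ A (cell i′) ]) [ cell i′ ↦ 1 ]
  swap-i : ∀ {i′} → i′ ≡ i → swap i′ (cell i) ≡ 1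
  swap-i refl = updated (A [ cell s ↦ A (cell i) ]) {cell i} refl
  j<s : j < cell s
  j<s = pred-mono-≤ (pred-mono-≤ i<s)
  swap-s : ∀ {i′} → i′ ≡ i → swap i′ (cell s) ≡ f i
  swap-s refl = trans (untouched (A [ cell s ↦ A j ]) (λ eq → <-irrefl (sym eq) j<s))
    (trans (updated A {cell s} refl) (A≡f j ≤-refl))
  swap-other : ∀ {i′ y} → i′ ≡ i → 2 ≤ y → y ≢ s → y ≢ i → swap i′ (cell y) ≡ A (cell y)
  swap-other refl 2≤y y≢s y≢i =
    trans (untouched (A [ cell s ↦ A j ]) (y≢i ∘ cell-injective 2≤y (s≤s (s≤s z≤n))))
          (untouched A (y≢s ∘ cell-injective 2≤y s≥2))
  swap-below : ∀ {i′} → i′ ≡ i → ∀ k → k < j → swap i′ k ≡ f (2 + k)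
  swap-below refl k k<j =
    trans (untouched (A [ cell s ↦ A j ]) (<⇒≢ k<j))
    (trans (untouched A (<⇒≢ (<-trans k<j j<s))) (A≡f k (<-trans k<j (n<1+n j))))
  extend : arr σ 3 i ≢ 0 → let ms′ = marked (arr σ 3) j in ∀ {ν τ} →
    ν ≡ μ × var τ 0 ≡ var σ 0 × var τ 1 ≡ var σ 1 × arr τ 0 ≡ arr σ 0
      × Rewired f (arr τ 1 ∘ cell) i ms′
      × (∀ y → 2 ≤ y → y ∉ i ∷ ms′ → arr τ 1 (cell y) ≡ swap (pred (var σ 2)) (cell y)) →
    Relinked f s ms σ μ ν τ
  extend i≢0 (ν≡ , v0 , v1 , b0 , r , kept) =
    ν≡ , v0 , v1 , b0
    , subst (Rewired f _ s) (sym ms≡i∷) (trans (kept s s≥2 s∉) (swap-s i≡′) ∷ r)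
    , λ y 2≤y y∉ →
        let y∉′ = subst (λ ms → y ∉ s ∷ ms) ms≡i∷ y∉ in
        trans (kept y 2≤y (y∉′ ∘ there)) (swap-other i≡′ 2≤y (y∉′ ∘ here) (y∉′ ∘ there ∘ here))
    where
    ms≡i∷ : ms ≡ i ∷ marked (arr σ 3) j
    ms≡i∷ = trans ms≡ (filter-accept (unmarked? (arr σ 3)) i≢0)

  Continuation : ℕ → State → Set
  Continuation ν τ = Runs relink ν τ (Relinked f s ms σ μ)

  current : State
  current = setVar 5 (arr σ 3 (pred (var σ 2))) (setVar 2 (pred (var σ 2)) σ)

  unchanged : arr σ 3 i ≡ 0 → Runs skip (10 + (j * 14 + suc μ)) current Continuation
  unchanged i≡0 = with-credit (s≤s (m≤n+m _ 9)) $ skips $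
    relink-runs j {f} {μ} {ms = ms}
      (trans ms≡ (filter-reject (unmarked? (arr σ 3)) λ i≢0 → i≢0 i≡0))
      i≡′ refl (<⇒≤ i<s) s≡1 (λ k k<j → A≡f k (<-trans k<j (n<1+n j)))

  exchange : arr σ 3 i ≢ 0 → Runs (fetch 5 2 ⨾ store 6 (` 5) ⨾ store 2 (lit 1) ⨾ 6 ≔ ` 2)
    (10 + (j * 14 + suc μ)) current Continuation
  exchange i≢0 =
    seqs $ seqs $ decrements $ seqs $ decrements $ reads $
    seqs $ seqs $ decrements $ seqs $ decrements $ writes $
    seqs $ seqs $ decrements $ seqs $ decrements $ writes $ copies $
    conclude (relink-runs j {f} {μ} refl i≡′ i≡′ ≤-refl (swap-i i≡′) (swap-below i≡′))
      λ {ν} {τ} → extend i≢0 {ν} {τ}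

rewired-range : ∀ {f g s ms i} → Rewired f g s ms → i ∈ s ∷ ms → g i ≡ 1 ⊎ ∃[ m ] m ∈ ms × g i ≡ f m
rewired-range ([] eq)  (here refl) = inj₁ eq
rewired-range (eq ∷ _) (here refl) = inj₂ (_ , here refl , eq)
rewired-range (_ ∷ r)  (there i∈) with rewired-range r i∈
... | inj₁ eq            = inj₁ eq
... | inj₂ (m , m∈ , eq) = inj₂ (m , there m∈ , eq)

-- The colour 1 of the vertices 1 and `n` differs from that of every walk, as starts are at least 2.
-- The pair of `n` is appended at position `n - 2`.
forward : Program
forward = 2 [ lit 1 ]≔ lit 1 ⨾ 2 [ ` 0 ]≔ lit 1 ⨾ 2 ≔ ` 0 ⨾ search ⨾
  store 0 (lit 1) ⨾ 6 ≔ ` 0 ⨾ 2 ≔ ` 0 ⨾ relink ⨾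
  4 ≔pred ` 0 ⨾ 4 ≔pred ` 4 ⨾ 0 [ ` 4 ]≔ ` 0 ⨾ 1 ≔suc ` 1

initial : ∀ {N f mark colour} → (∀ m → mark m ≡ 0) → (∀ y → colour y ≡ 0) →
  Colouring f (2 + N) mark (colour [ 1 ↦ 1 ] [ 2 + N ↦ 1 ]) (suc N) [] []
initial {N} {f} {mark} {colour} mark≡0 colour≡0 = record
  { distinct = []
  ; interior = []
  ; coloured = []
  ; one      = λ eq → 1+n≢0 (trans
      (sym (trans (untouched (colour [ 1 ↦ 1 ]) {2 + N} {1} {1} λ ()) (updated colour {1} refl))) eq)
  ; top      = λ eq → 1+n≢0 (trans (sym (updated (colour [ 1 ↦ 1 ]) {2 + N} refl)) eq)
  ; sound    = λ m≢0 → contradiction (mark≡0 _) m≢0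
  ; settled  = inj₂ ∘ settled
  ; seen     = λ 1+N<y y<2+N → contradiction y<2+N (≤⇒≯ 1+N<y)
  ; walked   = λ ()
  ; old      = inj₁ ∘ small
  ; own      = λ {y} 2≤i eq → contradiction (subst (_< 2) eq (small y)) (≤⇒≯ 2≤i)
  }
  where
  settled : ∀ {y} → (colour [ 1 ↦ 1 ] [ 2 + N ↦ 1 ]) y ≢ 0 → Settled f (2 + N) mark y
  settled {y} y≢0 with y ≟ 2 + N | y ≟ 1
  ... | yes y≡n | _       = [] , y , [] , [] , inj₂ (inj₁ y≡n)
  ... | no  _   | yes y≡1 = [] , y , [] , [] , inj₁ y≡1
  ... | no y≢n  | no y≢1  = contradiction
    (trans (untouched (colour [ 1 ↦ 1 ]) y≢n) (trans (untouched colour y≢1) (colour≡0 y))) y≢0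
  small : ∀ y → (colour [ 1 ↦ 1 ] [ 2 + N ↦ 1 ]) y < 2
  small y with y ≟ 2 + N | y ≟ 1
  ... | yes y≡n | _       = s≤s (≤-reflexive (updated (colour [ 1 ↦ 1 ]) y≡n))
  ... | no y≢n  | yes y≡1 = s≤s (≤-reflexive (trans (untouched (colour [ 1 ↦ 1 ]) y≢n) (updated colour y≡1)))
  ... | no y≢n  | no y≢1  = s≤s (≤-trans (≤-reflexive
    (trans (untouched (colour [ 1 ↦ 1 ]) y≢n) (trans (untouched colour y≢1) (colour≡0 y)))) z≤n)

Forwarded : (ℕ → ℕ) → ℕ → State → State → Set
Forwarded f N σ τ = var τ 1 ≡ suc (var σ 1) × arr τ 0 ≡ arr σ 0 [ N ↦ 2 + N ]
  × ∃[ mark ] ∃[ colour ] ∃[ ds ] Colouring f (2 + N) mark colour 1 ds []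
  × Rewired f (arr τ 1 ∘ cell) (2 + N) (marked mark N)
  × (∀ y → 2 ≤ y → y < 2 + N → y ∉ marked mark N → arr τ 1 (cell y) ≡ f y)

forward-runs : ∀ {N σ} → let f = arr σ 1 ∘ cell ; n = 2 + N in
  var σ 0 ≡ n → (∀ k → arr σ 2 k ≡ 0) → (∀ k → arr σ 3 k ≡ 0) →
  (∀ {y} → Interior n y → 1 ≤ f y × f y ≤ n) →
  Runs forward (50 * n) σ λ _ → Forwarded f N σ
forward-runs {N} {σ} n≡ zero₂ zero₃ f-range = with-credit enough $
  seqs $ writes $ seqs $ writes $ seqs $ copies $
  seqs $ conclude (search-runs f-range N {5 + (N * 14 + 5)} {ds = []} {r = n}
    (n≡ , refl , n≡ , refl , refl) ≤-refl
    (subst (λ z → Colouring f n (arr σ 3) (arr σ 2 [ 1 ↦ 1 ] [ z ↦ 1 ]) (suc N) [] [])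
      (sym n≡) (initial zero₃ zero₂)) refl)
  second-half
  where
  n = 2 + N
  f = arr σ 1 ∘ cell
  -- The search takes 16 per start and 13 per vertex, relinking 14 per round, 43 in all; rounding up
  -- to 50 leaves the slack `7 * N + 60`.
  total : ∀ N → 3 + (N * 16 + ((2 + N) * 13 + suc (5 + (N * 14 + 5)))) + (7 * N + 60) ≡ 50 * (2 + N)
  total = solve-∀
  enough : 3 + (N * 16 + (n * 13 + suc (5 + (N * 14 + 5)))) ≤ 50 * n
  enough = ≤-trans (m≤m+n _ (7 * N + 60)) (≤-reflexive (total N))

  second-half : ∀ {ν τ} → ν ≡ 5 + (N * 14 + 5)
      × Setting f-range 2 τ × ∃[ ds′ ] Colouring f n (arr τ 3) (arr τ 2) 1 ds′ [] →
    Runs (store 0 (lit 1) ⨾ 6 ≔ ` 0 ⨾ 2 ≔ ` 0 ⨾ relink ⨾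
      4 ≔pred ` 0 ⨾ 4 ≔pred ` 4 ⨾ 0 [ ` 4 ]≔ ` 0 ⨾ 1 ≔suc ` 1) ν τ λ _ → Forwarded f N σ
  second-half {τ = τ} (refl , (v0 , v1 , _ , b0 , b1) , ds , col) =
    seqs $ seqs $ decrements $ seqs $ decrements $ writes $ seqs $ copies $ seqs $ copies $ seqs $
    conclude (relink-runs N {f} {4} {ms = marked (arr τ 3) N} refl v0 v0 ≤-refl
      (updated (arr τ 1) (cong cell (sym v0)))
      λ k k<N → trans (untouched (arr τ 1) λ eq → <⇒≢ k<N (trans eq (cong cell v0)))
                  (cong (λ b → b k) b1))
    λ { (refl , w0 , w1 , c0 , r , kept) →
      seqs $ decrements $ seqs $ decrements $ seqs $ writes $ increments
      ( cong suc (trans w1 v1)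
      , trans (cong₂ (λ b z → b [ cell z ↦ z ]) c0 (trans w0 v0)) (cong (λ b → b [ N ↦ n ]) b0)
      , arr τ 3 , arr τ 2 , ds , col , r
      , λ y 2≤y y<n y∉ → trans
          (kept y 2≤y λ { (here refl) → <-irrefl refl y<n ; (there y∈) → y∉ y∈ })
          (trans (untouched (arr τ 1) λ eq →
                   <⇒≢ y<n (cell-injective 2≤y (s≤s (s≤s z≤n)) (trans eq (cong cell v0))))
                 (cong (λ b → b (cell y)) b1))) }

-- The path that settles `m` cannot leave its cycle, which contains neither 1 nor `n`. So it ends in
-- a mark, and the only cycle maximum on that cycle is `m`.
colouring-complete : ∀ {f N mark colour ds m} → Colouring f (2 + N) mark colour 1 ds [] →
  CycleMaximum f (2 + N) m → m ∈ marked mark N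
colouring-complete {f} {N} {mark} {m = m} col (2≤m , m<n , cs , c , cs<m)
  with Colouring.settled col (Colouring.seen col 2≤m m<n)
... | inj₂ (vs , z , p , _ , target) = from-target target
  where
  z∈ : z ∈ m ∷ cs
  z∈ = confined c p (here refl)
  below-m : All (λ y → 2 ≤ y × y ≤ m) (m ∷ cs)
  below-m = (2≤m , ≤-refl) ∷ All.map (map₂ <⇒≤) cs<m
  from-target : z ≡ 1 ⊎ z ≡ 2 + N ⊎ mark z ≢ 0 → m ∈ marked mark N
  from-target (inj₁ refl) = contradiction z∈ (1∉ below-m)
  from-target (inj₂ (inj₁ refl)) = contradiction (proj₂ (All.lookup below-m z∈)) (<⇒≱ m<n)
  from-target (inj₂ (inj₂ z≢0)) with split (m ∷ c) z∈
  ... | _ , _ , _ , q , _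
    with ≤-antisym (cycle-max (Colouring.sound col z≢0) (z ∷ q)) (proj₂ (All.lookup below-m z∈))
  ...   | refl = marked⁺ (2≤m , m<n) z≢0

-- Once all starts are used every vertex is coloured and settled, which is the reachability that
-- `maxima-rooted` asks for.
colouring-settled : ∀ {f N mark colour ds x} → Colouring f (2 + N) mark colour 1 ds [] →
  2 ≤ x → x < 2 + N → ∃[ vs ] ∃[ z ] Path f x vs z
    × All (Interior (2 + N)) vs × (z ≡ 1 ⊎ z ∈ 2 + N ∷ marked mark N)
colouring-settled col 2≤x x<n with Colouring.settled col (Colouring.seen col 2≤x x<n)
... | inj₂ (vs , z , p , int , inj₁ z≡1)        = vs , z , p , int , inj₁ z≡1
... | inj₂ (vs , z , p , int , inj₂ (inj₁ z≡n)) = vs , z , p , int , inj₂ (here z≡n)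
... | inj₂ (vs , z , p , int , inj₂ (inj₂ z≢0)) with Colouring.sound col z≢0
...   | 2≤z , z<n , _ = vs , z , p , int , inj₂ (there (marked⁺ (2≤z , z<n) z≢0))

-- Every value that relinking changes becomes 1 or a value of `f` at a cycle maximum.
target-range : ∀ {f g n ms} → Rewired f g n ms → (∀ {m} → m ∈ ms → CycleMaximum f n m) →
  (∀ {y} → 2 ≤ y → y < n → y ∉ ms → g y ≡ f y) →
  (∀ {x} → Interior n x → 1 ≤ f x × f x ≤ n) →
  ∀ {x} → 2 ≤ x → x ≤ n → 1 ≤ g x × g x ≤ n
target-range {n = n} {ms} rewired sound kept f-range {x} 2≤x x≤n with x ∈? n ∷ ms
... | no x∉ = subst (λ y → 1 ≤ y × y ≤ n) (sym (kept 2≤x x<n (x∉ ∘ there))) (f-range (2≤x , x<n))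
  where x<n = ≤∧≢⇒< x≤n (x∉ ∘ here)
... | yes x∈ with rewired-range rewired x∈
...   | inj₁ eq = subst (λ y → 1 ≤ y × y ≤ n) (sym eq) (≤-refl , <⇒≤ (≤-trans 2≤x x≤n))
...   | inj₂ (m , m∈ , eq) with sound m∈
...     | 2≤m , m<n , _ = subst (λ y → 1 ≤ y × y ≤ n) (sym eq) (f-range (2≤m , m<n))

forward-output : ∀ {N t} (f : 𝓕 (2 + N)) → let σ = input (2 + N) (pairs f) in
  Runs forward t σ (λ _ → Forwarded (code f) N σ) →
  ∃[ T ] IsΘ f T × (∀ T′ → IsΘ f T′ → parent T′ ≗ parent T)
    × (forward on⟨ 2 + N , pairs f ⟩outputs pairs (parent T) within t)
forward-output {N} {t} f (runs {τ} {k} e k≤ (v1 , a0 , mark , colour , ds , col , rewired , kept)) =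
  T , isΘ⇐ {f = f} repF {T} repG data′ , Θ-functional {f = f} {T} repF repG data′
    , τ , k , e
    , output-pairs (parent T) τ repG (trans v1 (cong suc (length-pairs f))) first (λ _ → refl)
    , m+n≤o⇒m≤o k k≤
  where
  n = 2 + N
  F = code f
  G = arr τ 1 ∘ cell
  ms = marked mark N

  repF : Represents f F
  repF = code-represents f

  sound : ∀ {m} → m ∈ ms → CycleMaximum F n m
  sound m∈ = Colouring.sound col (proj₂ (marked⁻ {j = N} m∈))

  kept′ : ∀ {y} → 2 ≤ y → y < n → y ∉ ms → G y ≡ F y
  kept′ = kept _

  data′ : ΘData F G n ms
  data′ = record
    { decreasing = marked-decreasing N
    ; sound      = sound
    ; complete   = colouring-complete col
    ; rewired    = rewired
    ; kept       = kept′
    }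

  G-range : ∀ {x} → 2 ≤ x → x ≤ n → 1 ≤ G x × G x ≤ n
  G-range = target-range rewired sound kept′ λ (2≤x , x<n) → range {h = f} repF 2≤x (s≤s⁻¹ x<n)

  parent′ : ⟦ 2 ⋯ n ⟧ → ⟦ 1 ⋯ n ⟧
  parent′ = restrict G G-range

  descends : ∀ {x} → 1 ≤ x → x ≤ n → ∃[ ws ] Path G x ws 1 × All (λ y → 2 ≤ y × y ≤ n) ws
  descends = maxima-rooted rewired kept′ sound (s≤s (s≤s z≤n)) (marked-decreasing N) (colouring-settled col)

  T : C⃗ n
  T = record
    { parent = parent′
    ; rooted = λ i → let (1≤i , i≤n) = bounds i ; (_ , p , ws≤n) = descends 1≤i i≤n in
                     path⇒star {h = parent′} (λ _ → refl) p ws≤n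
    }

  repG : Represents (parent T) G
  repG _ = refl

  first : ∀ {i} → i < suc N → arr τ 0 i ≡ 2 + i
  first {i} i<1+N with i ≟ N
  ... | yes refl = trans (cong (λ b → b N) a0) (updated (arr (input n (pairs f)) 0) {N} refl)
  ... | no i≢N = trans (cong (λ b → b i) a0) (trans (untouched (arr (input n (pairs f)) 0) i≢N)
    (cong proj₁ (entry-pairs f (⟪ 2 + i ⟫ {s≤s (s≤s z≤n)} {s≤s i<N}) refl)))
    where i<N = ≤∧≢⇒< (s≤s⁻¹ i<1+N) i≢N

forward-correct : ∀ N (f : 𝓕 (2 + N)) →
  ∃[ T ] IsΘ f T × (∀ T′ → IsΘ f T′ → parent T′ ≗ parent T)
    × (forward on⟨ 2 + N , pairs f ⟩outputs pairs (parent T) within 50 * (2 + N))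
forward-correct N f = forward-output f (forward-runs {N} refl (λ _ → refl) (λ _ → refl)
  λ (2≤y , y<n) → range {h = f} (code-represents f) 2≤y (s≤s⁻¹ y<n))

theorem3 : (∃[ p ] ∃[ c ] ∀ (n : ℕ) → 2 ≤ n → (f : 𝓕 n) →
    ∃[ T ] IsΘ f T
    × (∀ T′ → IsΘ f T′ → parent T′ ≗ parent T)
    × (p on⟨ n , pairs f ⟩outputs pairs (parent T) within c * n))
    × (∃[ q ] ∃[ c ] ∀ (n : ℕ) → 2 ≤ n → (T : C⃗ n) →
    ∃[ f ] IsΘ f T
    × (∀ f′ → IsΘ f′ T → f′ ≗ f)
    × (q on⟨ n , pairs (parent T) ⟩outputs pairs f within c * n))
theorem3 =
  (forward , 50 , λ { (suc (suc N)) (s≤s (s≤s z≤n)) f → forward-correct N f }) ,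
  (inverse , 20 , λ { (suc (suc N)) (s≤s (s≤s z≤n)) T → inverse-correct N T })
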